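{- For all integers $m,d\geq 1$, $$Q_{U_{m,d}}(t)=\binom{m+d}{d}\sum_{j=0}^{\lfloor (d-1)/2\rfloor}\frac{m(d-2j)}{(m+j)(m+d-j)}\binom{d}{j}t^j.$$
   Context: $U_{m,d}$ denotes the uniform matroid of rank $d$ on $m+d$ elements (independent sets are the subsets of size at most $d$). For a matroid $M$ on ground set $E$, $L(M)$ is its lattice of flats with minimal element $\hat 0=\mathrm{cl}(\emptyset)$ and maximal element $E$; for a flat $F$, $M_F$ is the restriction of $M$ to $F$ and $M^F$ is the contraction $M/F$. The characteristic polynomial is $\chi_M(t)=\sum_{F\in L(M)}\mu_{L(M)}(\hat 0,F)\,t^{\mathrm{rk}\,M-\mathrm{rk}\,F}$. The inverse Kazhdan–Lusztig polynomial $Q_M(t)\in\mathbb{Z}[t]$ is the unique assignment to each matroid such that $Q_M=1$ if $\mathrm{rk}\,M=0$, $\deg Q_M<\frac12\mathrm{rk}\,M$ if $\mathrm{rk}\,M>0$, and $t^{\mathrm{rk}\,M}(-1)^{\mathrm{rk}\,M}Q_M(t^{ -1})=\sum_{F\in L(M)}(-1)^{\mathrm{rk}\,M_F}Q_{M_F}(t)\,t^{\mathrm{rk}\,M^F}\chi_{M^F}(t^{ -1})$ for every $M$. -}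

module Defs where

open import Data.Bool using (Bool; true; false; _∧_; _∨_; not; if_then_else_; T)
open import Data.Nat as ℕ using (ℕ; zero; suc; _+_; _∸_; _≤_; _<_; _⊔_; _≡ᵇ_; _≤ᵇ_; _<ᵇ_)
open import Data.Nat.Combinatorics using (_C_)
open import Data.Integer as ℤ using (ℤ; +_; -_)
open import Data.Rational as ℚ using (ℚ; _/_)
open import Data.Fin using (Fin)
open import Data.Fin.Subset using (Subset; _⊆_; _∈_; _∉_; _∪_; _─_; ⁅_⁆; ∣_∣; ⊥)
open import Data.Vec using (Vec; []; _∷_; lookup; tabulate; zipWith)
open import Data.List using (List; []; _∷_; _++_; map; foldr; allFin; upTo)
open import Data.Product using (∃; _×_)
open import Relation.Binary.PropositionalEquality using (_≡_)

-- Polynomials in ℤ[t], represented by their coefficient sequences.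
-- (p k is the coefficient of t^k; equality of polynomials is pointwise.)

Poly : Set
Poly = ℕ → ℤ

_≈ᵖ_ : Poly → Poly → Set
p ≈ᵖ q = ∀ k → p k ≡ q k

onePoly : Poly
onePoly zero    = + 1
onePoly (suc _) = + 0

allᵇ : ∀ {A : Set} → (A → Bool) → List A → Bool
allᵇ p = foldr (λ a b → p a ∧ b) true

sumℤ : List ℤ → ℤ
sumℤ = foldr ℤ._+_ (+ 0)

_*ᵖ_ : Poly → Poly → Poly
(p *ᵖ q) k = sumℤ (map (λ i → p i ℤ.* q (k ∸ i)) (upTo (suc k)))

_·ᵖ_ : ℤ → Poly → Poly
(c ·ᵖ p) k = c ℤ.* p k

sumᵖ : List Poly → Poly
sumᵖ ps k = sumℤ (map (λ p → p k) ps)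

-- rev r p = t^r · p(t⁻¹)   (a polynomial whenever deg p ≤ r)
rev : ℕ → Poly → Poly
rev r p i = if i ≤ᵇ r then p (r ∸ i) else + 0

sgn : ℕ → ℤ
sgn zero          = + 1
sgn (suc zero)    = - (+ 1)
sgn (suc (suc k)) = sgn k

allSubsets : (n : ℕ) → List (Subset n)
allSubsets zero    = [] ∷ []
allSubsets (suc n) = map (true ∷_) (allSubsets n) ++ map (false ∷_) (allSubsets n)

_⊆ᵇ_ : ∀ {n} → Subset n → Subset n → Bool
[]      ⊆ᵇ []      = true
(x ∷ X) ⊆ᵇ (y ∷ Y) = (not x ∨ y) ∧ (X ⊆ᵇ Y)

_≟ˢ_ : ∀ {n} → Subset n → Subset n → Bool
X ≟ˢ Y = (X ⊆ᵇ Y) ∧ (Y ⊆ᵇ X)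

-- Matroids.  A matroid is given on a ground set E ⊆ Fin n by a (decidable)
-- independence predicate Ind; independent sets are subsets of E.
-- Keeping the ambient Fin n fixed lets restriction and contraction be
-- matroids on subsets E' ⊆ E of the same Fin n.

record IsMatroid {n : ℕ} (E : Subset n) (Ind : Subset n → Bool) : Set where
  field
    ind-⊆E    : ∀ X → T (Ind X) → X ⊆ E
    ind-empty : T (Ind ⊥)
    ind-down  : ∀ X Y → X ⊆ Y → T (Ind Y) → T (Ind X)
    ind-aug   : ∀ X Y → T (Ind X) → T (Ind Y) → ∣ X ∣ < ∣ Y ∣ →
                ∃ λ x → x ∈ Y × x ∉ X × T (Ind (X ∪ ⁅ x ⁆))

module _ {n : ℕ} (E : Subset n) (Ind : Subset n → Bool) where

  rank : Subset n → ℕ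
  rank X = foldr (λ Y acc → if Ind Y ∧ (Y ⊆ᵇ X) then ∣ Y ∣ ⊔ acc else acc)
                 0 (allSubsets n)

  rk : ℕ
  rk = rank E

  cl : Subset n → Subset n
  cl X = tabulate (λ x → lookup E x ∧ (rank (X ∪ ⁅ x ⁆) ≡ᵇ rank X))

  isFlat : Subset n → Bool
  isFlat F = (F ⊆ᵇ E) ∧
    allᵇ (λ x → not (lookup E x ∧ not (lookup F x)) ∨ (rank F <ᵇ rank (F ∪ ⁅ x ⁆)))
        (allFin n)

  flats : List (Subset n)
  flats = foldr (λ F acc → if isFlat F then F ∷ acc else acc) [] (allSubsets n)

  -- Möbius function of L(M) (ordered by inclusion):
  -- μ(F,F) = 1, μ(F,G) = - Σ_{F ≤ H < G} μ(F,H) for F < G, μ(F,G) = 0 otherwise.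
  -- The fuel argument bounds |G| (recursion is on strictly smaller flats).
  μ′ : ℕ → Subset n → Subset n → ℤ
  μ′ zero     F G = + 0
  μ′ (suc k) F G =
    if F ≟ˢ G then + 1
    else if F ⊆ᵇ G then
      - sumℤ (map (λ H → if (F ⊆ᵇ H) ∧ (H ⊆ᵇ G) ∧ not (H ≟ˢ G) then μ′ k F H else + 0)
                  flats)
    else + 0

  μ : Subset n → Subset n → ℤ
  μ F G = μ′ (suc ∣ G ∣) F G

  χ : Poly
  χ i = sumℤ (map (λ F → if (rk ∸ rank F) ≡ᵇ i then μ (cl ⊥) F else + 0) flats)

  restrE : Subset n → Subset n
  restrE F = F

  restrInd : Subset n → Subset n → Bool
  restrInd F X = Ind X ∧ (X ⊆ᵇ F)

  contrE : Subset n → Subset n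
  contrE F = E ─ F

  contrInd : Subset n → Subset n → Bool
  contrInd F X = (X ⊆ᵇ (E ─ F)) ∧ (rank (X ∪ F) ≡ᵇ (∣ X ∣ + rank F))

Assignment : Set
Assignment = (n : ℕ) → Subset n → (Subset n → Bool) → Poly

record IsInverseKL (Q : Assignment) : Set where
  field
    rank-zero : ∀ n (E : Subset n) Ind → IsMatroid E Ind →
                rk E Ind ≡ 0 → Q n E Ind ≈ᵖ onePoly
    degree    : ∀ n (E : Subset n) Ind → IsMatroid E Ind →
                0 < rk E Ind → ∀ k → rk E Ind ≤ 2 ℕ.* k → Q n E Ind k ≡ + 0
    recursion : ∀ n (E : Subset n) Ind → IsMatroid E Ind →
                (sgn (rk E Ind) ·ᵖ rev (rk E Ind) (Q n E Ind)) ≈ᵖ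
                sumᵖ (map (λ F →
                   let EF = restrE E Ind F ; IF = restrInd E Ind F
                       EF′ = contrE E Ind F ; IF′ = contrInd E Ind F
                   in sgn (rk EF IF) ·ᵖ
                      (Q n EF IF *ᵖ rev (rk EF′ IF′) (χ EF′ IF′)))
                   (flats E Ind))

U-E : (m d : ℕ) → Subset (m + d)
U-E m d = tabulate (λ _ → true)

U-Ind : (m d : ℕ) → Subset (m + d) → Bool
U-Ind m d X = ∣ X ∣ ≤ᵇ d

-- The coefficient  C(m+d,d) · m(d-2j) / ((m+j)(m+d-j)) · C(d,j)  of t^j, for m ≥ 1
-- (written with m = suc m′; for j ≤ d, m + d - j = m + (d ∸ j)).
uCoeff : (m d j : ℕ) → ℚ
uCoeff zero     d j = ℚ.0ℚ
uCoeff (suc m′) d j =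
  ((+ ((suc m′ + d) C d) ℤ.* + (suc m′) ℤ.* ((+ d) ℤ.- (+ (2 ℕ.* j))) ℤ.* + (d C j))
      / suc (m′ + j))
  ℚ.* ((+ 1) / suc (m′ + (d ∸ j)))

uRHS : (m d j : ℕ) → ℚ
uRHS m d j = if j ≤ᵇ ((d ∸ 1) ℕ./ 2) then uCoeff m d j else ℚ.0ℚ

{-# OPTIONS --safe #-}
module Submission where

-- A proper flat F of U = U_{m,d} has |F| < d, so U_F is Boolean and U^F is uniform of rank d − |F| on
-- m + d − |F| elements.  Compare the coefficients of t^(d−j), 2j < d, in the recursion for a uniform
-- matroid of rank d on N elements: Q_F = 1 for proper flats F, and the summand of F = E vanishes by the degree
-- bound, so (−1)^d times the coefficient of t^j in Q is
--   Σ_{k<j} (−1)^k C(N,k) (−1)^(d−j) C(N−k,d−j) + (−1)^j C(N,j) μ(∅, E_{N−j,d−j}),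
-- where E_{n,r} is the top flat of the uniform matroid of rank r on n elements.  For N = d this equals
-- (−1)^d [j = 0], so Boolean matroids have Q = 1; for N = m + d, partial alternating sums of binomials
-- collapse it to the stated coefficient.

open import Defs
open import Data.Nat using (ℕ; _≤_; _+_)
open import Data.Rational using (_/_)
open import Relation.Binary.PropositionalEquality using (_≡_)

open import Data.Bool using (Bool; true; false; _∧_; _∨_; not; if_then_else_; T)
import Data.Bool.Properties as Boolₚ
open import Data.Nat as ℕ using (zero; suc; _∸_; _<_; _⊓_; _⊔_; _≡ᵇ_; _≤ᵇ_; _<ᵇ_; z≤n; s≤s)
import Data.Nat.Properties as ℕₚ
open import Data.Nat.Combinatorics using (_C_; nCn≡1; nCk+nC[k+1]≡[n+1]C[k+1]; k>n⇒nCk≡0; nCk≡nC[n∸k])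
open import Data.Nat.DivMod using (m/n*n≤m; m*n/n≡m; /-monoˡ-≤)
open import Data.Integer as ℤ using (ℤ; +_; -_)
import Data.Integer.Properties as ℤₚ
open import Data.Integer.Tactic.RingSolver using (solve-∀)
import Data.Rational as ℚ
import Data.Rational.Properties as ℚₚ
open import Data.Rational.Unnormalised as ℚᵘ using (mkℚᵘ; *≡*)
import Data.Rational.Unnormalised.Properties as ℚᵘₚ
open import Data.Fin using (Fin; zero; suc)
open import Data.Fin.Subset using (Subset; _⊆_; _∈_; _∉_; _∪_; _─_; ⁅_⁆; ∣_∣; ⊥)
import Data.Fin.Subset.Properties as Subsetₚ
open import Data.Vec using ([]; _∷_; lookup; tabulate; here; there)
open import Data.Vec.Properties using ([]=⇒lookup; lookup⇒[]=; tabulate-cong; tabulate∘lookup; lookup-replicate)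
open import Data.List using ([]; _∷_; _++_; map; foldr; allFin; upTo; applyUpTo)
open import Data.List.Properties using (map-∘; map-cong; map-++; map-applyUpTo)
open import Data.List.Relation.Unary.Any using (here; there)
open import Data.List.Membership.Propositional using () renaming (_∈_ to _∈ˡ_)
open import Data.List.Membership.Propositional.Properties using (∈-++⁺ˡ; ∈-++⁺ʳ; ∈-map⁺; ∈-allFin)
open import Data.Product using (∃; _×_; _,_)
open import Data.Empty using (⊥-elim)
open import Function using (_∘_)
open import Relation.Binary.Definitions using (tri<; tri≈; tri>)
open import Relation.Nullary using (¬_; yes; no)
open import Relation.Binary.PropositionalEquality using (_≢_; refl; sym; trans; cong; cong₂; subst; module ≡-Reasoning)

-- The recursion at `E` does not have to be solved: at the chosen exponents the unknown polynomial
-- occurs only once, on the left. Besides the Möbius values, the only input is Q = 1 for Boolean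
-- matroids, itself obtained by induction on the size from the same coefficient formula. The
-- obstacle is that independence predicates are functions. Restriction and contraction yield
-- predicates that agree with a uniform one only pointwise, and an assignment `Q` may tell such
-- predicates apart. So uniformity is a pointwise hypothesis, and each statement about Q or χ is
-- made for every predicate satisfying it. The denominators come from n Σ_{k<r} (-1)^k C(n,k) =
-- -(-1)^r r C(n,r). It is used twice, with n = N - (d-j) = m + j and with n = N - j = m + d - j.

-- Boolean tests on natural numbers

T→≡true : ∀ {b} → T b → b ≡ true
T→≡true {true} _ = refl

≡true→T : ∀ {b} → b ≡ true → T b
≡true→T refl = _

¬T→≡false : ∀ {b} → ¬ T b → b ≡ false
¬T→≡false {false} _ = refl
¬T→≡false {true}  h = ⊥-elim (h _)

<⇒<ᵇ≡true : ∀ {m n} → m < n → (m <ᵇ n) ≡ true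
<⇒<ᵇ≡true m<n = T→≡true (ℕₚ.<⇒<ᵇ m<n)

≥⇒<ᵇ≡false : ∀ {m n} → n ≤ m → (m <ᵇ n) ≡ false
≥⇒<ᵇ≡false {m} {n} n≤m = ¬T→≡false (λ t → ℕₚ.<⇒≱ (ℕₚ.<ᵇ⇒< m n t) n≤m)

≤⇒≤ᵇ≡true : ∀ {m n} → m ≤ n → (m ≤ᵇ n) ≡ true
≤⇒≤ᵇ≡true m≤n = T→≡true (ℕₚ.≤⇒≤ᵇ m≤n)

>⇒≤ᵇ≡false : ∀ {m n} → n < m → (m ≤ᵇ n) ≡ false
>⇒≤ᵇ≡false {m} {n} n<m = ¬T→≡false (λ t → ℕₚ.<⇒≱ n<m (ℕₚ.≤ᵇ⇒≤ m n t))

≡⇒≡ᵇ≡true : ∀ {m n} → m ≡ n → (m ≡ᵇ n) ≡ true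
≡⇒≡ᵇ≡true {m} {n} eq = T→≡true (ℕₚ.≡⇒≡ᵇ m n eq)

≢⇒≡ᵇ≡false : ∀ {m n} → m ≢ n → (m ≡ᵇ n) ≡ false
≢⇒≡ᵇ≡false {m} {n} m≢n = ¬T→≡false (m≢n ∘ ℕₚ.≡ᵇ⇒≡ m n)

-- Binomial sums

-- binomSum g n = Σₖ (n C k) · g k, by Pascal's rule.
binomSum : (ℕ → ℤ) → ℕ → ℤ
binomSum g zero    = g 0
binomSum g (suc n) = binomSum g n ℤ.+ binomSum (g ∘ suc) n

binomSum-cong : ∀ {g h} n → (∀ k → k ≤ n → g k ≡ h k) → binomSum g n ≡ binomSum h n
binomSum-cong zero    eq = eq 0 z≤n
binomSum-cong (suc n) eq = cong₂ ℤ._+_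
  (binomSum-cong n (λ k k≤n → eq k (ℕₚ.m≤n⇒m≤1+n k≤n)))
  (binomSum-cong n (λ k k≤n → eq (suc k) (s≤s k≤n)))

binomSum-+ : ∀ g h n → binomSum (λ k → g k ℤ.+ h k) n ≡ binomSum g n ℤ.+ binomSum h n
binomSum-+ g h zero    = refl
binomSum-+ g h (suc n) rewrite binomSum-+ g h n | binomSum-+ (g ∘ suc) (h ∘ suc) n =
  interchange (binomSum g n) (binomSum h n) (binomSum (g ∘ suc) n) (binomSum (h ∘ suc) n)
  where
  interchange : ∀ a b c d → (a ℤ.+ b) ℤ.+ (c ℤ.+ d) ≡ (a ℤ.+ c) ℤ.+ (b ℤ.+ d)
  interchange = solve-∀

binomSum-*ˡ : ∀ c g n → binomSum (λ k → c ℤ.* g k) n ≡ c ℤ.* binomSum g n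
binomSum-*ˡ c g zero    = refl
binomSum-*ˡ c g (suc n) rewrite binomSum-*ˡ c g n | binomSum-*ˡ c (g ∘ suc) n =
  sym (ℤₚ.*-distribˡ-+ c (binomSum g n) (binomSum (g ∘ suc) n))

binomSum-0 : ∀ n → binomSum (λ _ → + 0) n ≡ + 0
binomSum-0 zero    = refl
binomSum-0 (suc n) rewrite binomSum-0 n = refl

-- An integer-valued copy of `_C_` for which Pascal's rule holds by computation, in the same order
-- of summands as in `binomSum`.
binom : ℕ → ℕ → ℤ
binom n       zero    = + 1
binom zero    (suc k) = + 0
binom (suc n) (suc k) = binom n (suc k) ℤ.+ binom n k

binom≡C : ∀ n k → binom n k ≡ + (n C k)
binom≡C n       zero    = cong +_ (sym (trans (nCk≡nC[n∸k] (z≤n {n})) (nCn≡1 n)))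
binom≡C zero    (suc k) = refl
binom≡C (suc n) (suc k) = begin
  binom n (suc k) ℤ.+ binom n k     ≡⟨ cong₂ ℤ._+_ (binom≡C n (suc k)) (binom≡C n k) ⟩
  + (n C suc k) ℤ.+ + (n C k)       ≡⟨ ℤₚ.pos-+ (n C suc k) (n C k) ⟨
  + (n C suc k + n C k)             ≡⟨ cong +_ (ℕₚ.+-comm (n C suc k) (n C k)) ⟩
  + (n C k + n C suc k)             ≡⟨ cong +_ (nCk+nC[k+1]≡[n+1]C[k+1] n k) ⟩
  + (suc n C suc k)                 ∎
  where open ≡-Reasoning

k>n⇒binom≡0 : ∀ {n k} → n < k → binom n k ≡ + 0
k>n⇒binom≡0 {n} {k} n<k = trans (binom≡C n k) (cong +_ (k>n⇒nCk≡0 n<k))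

binom-n-n : ∀ n → binom n n ≡ + 1
binom-n-n n = trans (binom≡C n n) (cong +_ (nCn≡1 n))

binom-sym : ∀ a b → binom (a + b) a ≡ binom (a + b) b
binom-sym a b = begin
  binom (a + b) a            ≡⟨ binom≡C (a + b) a ⟩
  + ((a + b) C a)            ≡⟨ cong +_ (nCk≡nC[n∸k] (ℕₚ.m≤m+n a b)) ⟩
  + ((a + b) C (a + b ∸ a))  ≡⟨ cong (λ c → + ((a + b) C c)) (ℕₚ.m+n∸m≡n a b) ⟩
  + ((a + b) C b)            ≡⟨ binom≡C (a + b) b ⟨
  binom (a + b) b            ∎
  where open ≡-Reasoning

pointMass : ℕ → ℤ → ℕ → ℤ
pointMass i x k = if k ≡ᵇ i then x else + 0

binomSum-pointMass : ∀ i x n → binomSum (pointMass i x) n ≡ binom n i ℤ.* x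
binomSum-pointMass zero    x zero    = sym (ℤₚ.*-identityˡ x)
binomSum-pointMass (suc i) x zero    = refl
binomSum-pointMass zero    x (suc n)
  rewrite binomSum-pointMass zero x n | binomSum-0 n = ℤₚ.+-identityʳ _
binomSum-pointMass (suc i) x (suc n)
  rewrite binomSum-pointMass (suc i) x n | binomSum-pointMass i x n =
  sym (ℤₚ.*-distribʳ-+ x (binom n (suc i)) (binom n i))

sgn-suc : ∀ k → sgn (suc k) ≡ - sgn k
sgn-suc zero          = refl
sgn-suc (suc zero)    = refl
sgn-suc (suc (suc k)) = sgn-suc k

sgn-+ : ∀ a b → sgn (a + b) ≡ sgn a ℤ.* sgn b
sgn-+ zero    b = sym (ℤₚ.*-identityˡ (sgn b))
sgn-+ (suc a) b rewrite sgn-suc (a + b) | sgn-suc a | sgn-+ a b = ℤₚ.neg-distribˡ-* (sgn a) (sgn b)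

sgn-sq : ∀ k → sgn k ℤ.* sgn k ≡ + 1
sgn-sq zero          = refl
sgn-sq (suc zero)    = refl
sgn-sq (suc (suc k)) = sgn-sq k

below : ℕ → (ℕ → ℤ) → ℕ → ℤ
below r g k = if k <ᵇ r then g k else + 0

below-< : ∀ {r k} g → k < r → below r g k ≡ g k
below-< g k<r rewrite <⇒<ᵇ≡true k<r = refl

below-≥ : ∀ {r k} g → r ≤ k → below r g k ≡ + 0
below-≥ g r≤k rewrite ≥⇒<ᵇ≡false r≤k = refl

-- Since `binomSum` always runs over all k ≤ n, the truncation to k < r sits in the summand. For r ≤
-- n this is the sum of μ(∅, H) over the proper flats H of a uniform matroid of rank r on n
-- elements.
altSum : ℕ → ℕ → ℤ
altSum r n = binomSum (below r sgn) n

-- Pascal's rule and the alternating sign turn the left side into the difference of two consecutive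
-- partial sums over the same n. Only the term at k = r survives.
altSum-suc : ∀ r n → altSum (suc r) (suc n) ≡ sgn r ℤ.* binom n r
altSum-suc r n = trans (cong (λ z → altSum (suc r) n ℤ.+ z) shifted) (step r n)
  where
  shift : ∀ k → below (suc r) sgn (suc k) ≡ - + 1 ℤ.* below r sgn k
  shift k with k <ᵇ r
  ... | false = refl
  ... | true  = trans (sgn-suc k) (sym (ℤₚ.-1*i≡-i (sgn k)))
  shifted : binomSum (λ k → below (suc r) sgn (suc k)) n ≡ - + 1 ℤ.* altSum r n
  shifted = trans (binomSum-cong n (λ k _ → shift k)) (binomSum-*ˡ (- + 1) (below r sgn) n)
  step : ∀ r n → altSum (suc r) n ℤ.+ - + 1 ℤ.* altSum r n ≡ sgn r ℤ.* binom n r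
  step zero    zero    = refl
  step (suc r) zero    = sym (ℤₚ.*-zeroʳ (sgn (suc r)))
  step zero    (suc n) rewrite altSum-suc zero n | binomSum-0 n = refl
  step (suc r) (suc n) rewrite altSum-suc (suc r) n | altSum-suc r n | sgn-suc r =
    rearrange (sgn r) (binom n (suc r)) (binom n r)
    where
    rearrange : ∀ σ a b → - σ ℤ.* a ℤ.+ - + 1 ℤ.* (σ ℤ.* b) ≡ - σ ℤ.* (a ℤ.+ b)
    rearrange = solve-∀

-- C(n,k) C(n−k,s) = C(n,s) C(n−s,k): choose the s-subset first.
binomSum-choose : ∀ f s n →
  binomSum (λ k → f k ℤ.* binom (n ∸ k) s) n ≡ binom n s ℤ.* binomSum f (n ∸ s)
binomSum-choose f zero n = trans
  (binomSum-cong n (λ k _ → ℤₚ.*-identityʳ (f k)))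
  (sym (ℤₚ.*-identityˡ (binomSum f n)))
binomSum-choose f (suc s) zero    = ℤₚ.*-zeroʳ (f 0)
binomSum-choose f (suc s) (suc n) = begin
  binomSum (λ k → f k ℤ.* binom (suc n ∸ k) (suc s)) n
    ℤ.+ binomSum (λ k → f (suc k) ℤ.* binom (n ∸ k) (suc s)) n
    ≡⟨ cong₂ ℤ._+_ (trans (binomSum-cong n split) (binomSum-+ _ _ n)) (binomSum-choose (f ∘ suc) (suc s) n) ⟩
  (binomSum (λ k → f k ℤ.* binom (n ∸ k) (suc s)) n ℤ.+ binomSum (λ k → f k ℤ.* binom (n ∸ k) s) n)
    ℤ.+ binom n (suc s) ℤ.* binomSum (f ∘ suc) (n ∸ suc s)
    ≡⟨ cong (ℤ._+ binom n (suc s) ℤ.* binomSum (f ∘ suc) (n ∸ suc s))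
         (cong₂ ℤ._+_ (binomSum-choose f (suc s) n) (binomSum-choose f s n)) ⟩
  (binom n (suc s) ℤ.* binomSum f (n ∸ suc s) ℤ.+ binom n s ℤ.* binomSum f (n ∸ s))
    ℤ.+ binom n (suc s) ℤ.* binomSum (f ∘ suc) (n ∸ suc s)
    ≡⟨ combine ⟩
  binom (suc n) (suc s) ℤ.* binomSum f (n ∸ s) ∎
  where
  open ≡-Reasoning
  split : ∀ k → k ≤ n → f k ℤ.* binom (suc n ∸ k) (suc s) ≡
          f k ℤ.* binom (n ∸ k) (suc s) ℤ.+ f k ℤ.* binom (n ∸ k) s
  split k k≤n rewrite ℕₚ.+-∸-assoc 1 k≤n =
    ℤₚ.*-distribˡ-+ (f k) (binom (n ∸ k) (suc s)) (binom (n ∸ k) s)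
  regroup : ∀ a b x y → (a ℤ.* x ℤ.+ b ℤ.* (x ℤ.+ y)) ℤ.+ a ℤ.* y ≡ (a ℤ.+ b) ℤ.* (x ℤ.+ y)
  regroup = solve-∀
  vanish : ∀ b x y z → (+ 0 ℤ.* x ℤ.+ b ℤ.* z) ℤ.+ + 0 ℤ.* y ≡ (+ 0 ℤ.+ b) ℤ.* z
  vanish = solve-∀
  combine : (binom n (suc s) ℤ.* binomSum f (n ∸ suc s) ℤ.+ binom n s ℤ.* binomSum f (n ∸ s))
    ℤ.+ binom n (suc s) ℤ.* binomSum (f ∘ suc) (n ∸ suc s)
    ≡ (binom n (suc s) ℤ.+ binom n s) ℤ.* binomSum f (n ∸ s)
  combine with suc s ℕ.≤? n
  -- For s ≥ n both truncated differences are 0, so `binomSum f (n ∸ s)` cannot be unfolded by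
  -- Pascal's rule; C(n,s+1) = 0 removes the terms that would require it.
  ... | no s≮n rewrite k>n⇒binom≡0 (ℕₚ.≰⇒> s≮n) =
    vanish (binom n s) (binomSum f (n ∸ suc s)) (binomSum (f ∘ suc) (n ∸ suc s)) (binomSum f (n ∸ s))
  ... | yes s<n rewrite ℕₚ.+-∸-assoc 1 s<n =
    regroup (binom n (suc s)) (binom n s) (binomSum f (n ∸ suc s)) (binomSum (f ∘ suc) (n ∸ suc s))

-- This is `binomSum-choose` for the point mass at i, which reduces each sum to one term.
binom-trinomial : ∀ n i j → binom n i ℤ.* binom (n ∸ i) j ≡ binom n j ℤ.* binom (n ∸ j) i
binom-trinomial n i j = begin
  binom n i ℤ.* binom (n ∸ i) j
    ≡⟨ binomSum-pointMass i _ n ⟨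
  binomSum (pointMass i (binom (n ∸ i) j)) n
    ≡⟨ binomSum-cong n (λ k _ → at k) ⟩
  binomSum (λ k → pointMass i (+ 1) k ℤ.* binom (n ∸ k) j) n
    ≡⟨ binomSum-choose (pointMass i (+ 1)) j n ⟩
  binom n j ℤ.* binomSum (pointMass i (+ 1)) (n ∸ j)
    ≡⟨ cong (binom n j ℤ.*_) (trans (binomSum-pointMass i (+ 1) (n ∸ j)) (ℤₚ.*-identityʳ _)) ⟩
  binom n j ℤ.* binom (n ∸ j) i ∎
  where
  open ≡-Reasoning
  at : ∀ k → pointMass i (binom (n ∸ i) j) k ≡ pointMass i (+ 1) k ℤ.* binom (n ∸ k) j
  at k with k ≡ᵇ i in eq
  ... | false = refl
  ... | true rewrite ℕₚ.≡ᵇ⇒≡ k i (≡true→T eq) = sym (ℤₚ.*-identityˡ _)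

binom-absorption : ∀ n k → + suc k ℤ.* binom (suc n) (suc k) ≡ + suc n ℤ.* binom n k
binom-absorption zero zero = refl
binom-absorption zero (suc k) = ℤₚ.*-zeroʳ (+ suc (suc k))
binom-absorption (suc n) zero =
  trans (expand (binom (suc n) 1)) (trans (cong (λ z → z ℤ.+ + 1) (binom-absorption n zero)) (finish (+ suc n)))
  where
  expand : ∀ a → + 1 ℤ.* (a ℤ.+ + 1) ≡ + 1 ℤ.* a ℤ.+ + 1
  expand = solve-∀
  finish : ∀ a → a ℤ.* + 1 ℤ.+ + 1 ≡ (+ 1 ℤ.+ a) ℤ.* + 1
  finish = solve-∀
binom-absorption (suc n) (suc k) = begin
  + (2 + k) ℤ.* binom (2 + n) (2 + k)
    ≡⟨⟩
  + (2 + k) ℤ.* (binom (suc n) (2 + k) ℤ.+ binom (suc n) (suc k))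
    ≡⟨ expand (+ suc k) (binom (suc n) (2 + k)) (binom (suc n) (suc k)) ⟩
  + (2 + k) ℤ.* binom (suc n) (2 + k) ℤ.+ + suc k ℤ.* binom (suc n) (suc k) ℤ.+ binom (suc n) (suc k)
    ≡⟨ cong (ℤ._+ binom (suc n) (suc k)) (cong₂ ℤ._+_ (binom-absorption n (suc k)) (binom-absorption n k)) ⟩
  + suc n ℤ.* binom n (suc k) ℤ.+ + suc n ℤ.* binom n k ℤ.+ binom (suc n) (suc k)
    ≡⟨ cong (ℤ._+ binom (suc n) (suc k)) (ℤₚ.*-distribˡ-+ (+ suc n) (binom n (suc k)) (binom n k)) ⟨
  + suc n ℤ.* (binom n (suc k) ℤ.+ binom n k) ℤ.+ binom (suc n) (suc k)
    ≡⟨⟩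
  + suc n ℤ.* binom (suc n) (suc k) ℤ.+ binom (suc n) (suc k)
    ≡⟨ collect (+ suc n) (binom (suc n) (suc k)) ⟩
  + (2 + n) ℤ.* binom (suc n) (suc k) ∎
  where
  open ≡-Reasoning
  expand : ∀ a x y → (+ 1 ℤ.+ a) ℤ.* (x ℤ.+ y) ≡ (+ 1 ℤ.+ a) ℤ.* x ℤ.+ a ℤ.* y ℤ.+ y
  expand = solve-∀
  collect : ∀ a x → a ℤ.* x ℤ.+ x ≡ (+ 1 ℤ.+ a) ℤ.* x
  collect = solve-∀

-- Subsets and sums over subsets

∧-trueˡ : ∀ {a b} → a ∧ b ≡ true → a ≡ true
∧-trueˡ {true} _ = refl

∧-trueʳ : ∀ {a b} → a ∧ b ≡ true → b ≡ true
∧-trueʳ {true} eq = eq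

⊆ᵇ-refl : ∀ {n} (X : Subset n) → X ⊆ᵇ X ≡ true
⊆ᵇ-refl []          = refl
⊆ᵇ-refl (true ∷ X)  = ⊆ᵇ-refl X
⊆ᵇ-refl (false ∷ X) = ⊆ᵇ-refl X

⊥-⊆ᵇ : ∀ {n} (X : Subset n) → ⊥ ⊆ᵇ X ≡ true
⊥-⊆ᵇ []      = refl
⊥-⊆ᵇ (x ∷ X) = ⊥-⊆ᵇ X

⊆ᵇ-trans : ∀ {n} (X Y Z : Subset n) → X ⊆ᵇ Y ≡ true → Y ⊆ᵇ Z ≡ true → X ⊆ᵇ Z ≡ true
⊆ᵇ-trans []          []          []          _ _ = refl
⊆ᵇ-trans (false ∷ X) (true ∷ Y)  (true ∷ Z)  p q = ⊆ᵇ-trans X Y Z p q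
⊆ᵇ-trans (false ∷ X) (false ∷ Y) (z ∷ Z)     p q = ⊆ᵇ-trans X Y Z p q
⊆ᵇ-trans (true ∷ X)  (true ∷ Y)  (true ∷ Z)  p q = ⊆ᵇ-trans X Y Z p q

⊆ᵇ⇒∣∣≤ : ∀ {n} (X Y : Subset n) → X ⊆ᵇ Y ≡ true → ∣ X ∣ ≤ ∣ Y ∣
⊆ᵇ⇒∣∣≤ []          []          _ = z≤n
⊆ᵇ⇒∣∣≤ (true ∷ X)  (true ∷ Y)  p = s≤s (⊆ᵇ⇒∣∣≤ X Y p)
⊆ᵇ⇒∣∣≤ (false ∷ X) (true ∷ Y)  p = ℕₚ.m≤n⇒m≤1+n (⊆ᵇ⇒∣∣≤ X Y p)
⊆ᵇ⇒∣∣≤ (false ∷ X) (false ∷ Y) p = ⊆ᵇ⇒∣∣≤ X Y p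

⊆ᵇ∧∣∣≥⇒≡ : ∀ {n} (X Y : Subset n) → X ⊆ᵇ Y ≡ true → ∣ Y ∣ ≤ ∣ X ∣ → X ≡ Y
⊆ᵇ∧∣∣≥⇒≡ []          []          _ _       = refl
⊆ᵇ∧∣∣≥⇒≡ (true ∷ X)  (true ∷ Y)  p (s≤s q) = cong (true ∷_) (⊆ᵇ∧∣∣≥⇒≡ X Y p q)
⊆ᵇ∧∣∣≥⇒≡ (false ∷ X) (true ∷ Y)  p q       = ⊥-elim (ℕₚ.<⇒≱ q (⊆ᵇ⇒∣∣≤ X Y p))
⊆ᵇ∧∣∣≥⇒≡ (false ∷ X) (false ∷ Y) p q       = cong (false ∷_) (⊆ᵇ∧∣∣≥⇒≡ X Y p q)

-- For nested sets equality is a matter of size. This makes the condition H ≠ G in the Möbius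
-- recursion depend on cardinalities alone.
≟ˢ-⊆ᵇ : ∀ {n} (X Y : Subset n) → X ⊆ᵇ Y ≡ true → (X ≟ˢ Y) ≡ (∣ X ∣ ≡ᵇ ∣ Y ∣)
≟ˢ-⊆ᵇ X Y p rewrite p with ∣ X ∣ ℕ.≟ ∣ Y ∣
... | yes eq rewrite ⊆ᵇ∧∣∣≥⇒≡ X Y p (ℕₚ.≤-reflexive (sym eq)) | ≡⇒≡ᵇ≡true {∣ Y ∣} refl = ⊆ᵇ-refl Y
... | no neq rewrite ≢⇒≡ᵇ≡false neq = ¬T→≡false
  (λ t → neq (ℕₚ.≤-antisym (⊆ᵇ⇒∣∣≤ X Y p) (⊆ᵇ⇒∣∣≤ Y X (T→≡true t))))

⊆ᵇ⇒⊆ : ∀ {n} (X Y : Subset n) → X ⊆ᵇ Y ≡ true → X ⊆ Y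
⊆ᵇ⇒⊆ (true ∷ X)  (true ∷ Y) p here      = here
⊆ᵇ⇒⊆ (true ∷ X)  (true ∷ Y) p (there h) = there (⊆ᵇ⇒⊆ X Y p h)
⊆ᵇ⇒⊆ (false ∷ X) (y ∷ Y)    p (there h) = there (⊆ᵇ⇒⊆ X Y p h)

⊆⇒⊆ᵇ : ∀ {n} (X Y : Subset n) → X ⊆ Y → X ⊆ᵇ Y ≡ true
⊆⇒⊆ᵇ []          []      h = refl
⊆⇒⊆ᵇ (true ∷ X)  (y ∷ Y) h with h here
... | here = ⊆⇒⊆ᵇ X Y (λ p → Subsetₚ.drop-there (h (there p)))
⊆⇒⊆ᵇ (false ∷ X) (y ∷ Y) h = ⊆⇒⊆ᵇ X Y (λ p → Subsetₚ.drop-there (h (there p)))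

∪-⊆ᵇ : ∀ {n} (X Y Z : Subset n) → X ⊆ᵇ Z ≡ true → Y ⊆ᵇ Z ≡ true → (X ∪ Y) ⊆ᵇ Z ≡ true
∪-⊆ᵇ []          []          []         p q = refl
∪-⊆ᵇ (true ∷ X)  (true ∷ Y)  (true ∷ Z) p q = ∪-⊆ᵇ X Y Z p q
∪-⊆ᵇ (true ∷ X)  (false ∷ Y) (true ∷ Z) p q = ∪-⊆ᵇ X Y Z p q
∪-⊆ᵇ (false ∷ X) (true ∷ Y)  (true ∷ Z) p q = ∪-⊆ᵇ X Y Z p q
∪-⊆ᵇ (false ∷ X) (false ∷ Y) (z ∷ Z)    p q = ∪-⊆ᵇ X Y Z p q

⁅⁆-⊆ᵇ : ∀ {n} (x : Fin n) X → lookup X x ≡ true → ⁅ x ⁆ ⊆ᵇ X ≡ true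
⁅⁆-⊆ᵇ zero    (true ∷ X) _ = ⊥-⊆ᵇ X
⁅⁆-⊆ᵇ (suc x) (_ ∷ X)    p = ⁅⁆-⊆ᵇ x X p

∣∪⁅⁆∣ : ∀ {n} (X : Subset n) x → lookup X x ≡ false → ∣ X ∪ ⁅ x ⁆ ∣ ≡ suc ∣ X ∣
∣∪⁅⁆∣ (false ∷ X) zero    _ = cong suc (cong ∣_∣ (Subsetₚ.∪-identityʳ X))
∣∪⁅⁆∣ (true ∷ X)  (suc x) p = cong suc (∣∪⁅⁆∣ X x p)
∣∪⁅⁆∣ (false ∷ X) (suc x) p = ∣∪⁅⁆∣ X x p

element-outside : ∀ {n} (X Y : Subset n) → ∣ X ∣ < ∣ Y ∣ → ∃ λ x → lookup Y x ≡ true × lookup X x ≡ false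
element-outside (false ∷ X) (true ∷ Y)  h = zero , refl , refl
element-outside (true ∷ X)  (true ∷ Y)  (s≤s h) with element-outside X Y h
... | x , p = suc x , p
element-outside (false ∷ X) (false ∷ Y) h with element-outside X Y h
... | x , p = suc x , p
element-outside (true ∷ X)  (false ∷ Y) h with element-outside X Y (ℕₚ.<⇒≤ h)
... | x , p = suc x , p

subset-of-size : ∀ {n} r (X : Subset n) → r ≤ ∣ X ∣ → ∃ λ Y → Y ⊆ᵇ X ≡ true × ∣ Y ∣ ≡ r
subset-of-size {n} zero X _ = ⊥ , ⊥-⊆ᵇ X , Subsetₚ.∣⊥∣≡0 n
subset-of-size (suc r) (true ∷ X) (s≤s h) with subset-of-size r X h
... | Y , p , q = true ∷ Y , p , cong suc q
subset-of-size (suc r) (false ∷ X) h with subset-of-size (suc r) X h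
... | Y , p , q = false ∷ Y , p , q

∣─∣ : ∀ {n} (E F : Subset n) → F ⊆ᵇ E ≡ true → ∣ E ─ F ∣ + ∣ F ∣ ≡ ∣ E ∣
∣─∣ []          []          _ = refl
∣─∣ (true ∷ E)  (true ∷ F)  p = trans (ℕₚ.+-suc _ _) (cong suc (∣─∣ E F p))
∣─∣ (true ∷ E)  (false ∷ F) p = cong suc (∣─∣ E F p)
∣─∣ (false ∷ E) (false ∷ F) p = ∣─∣ E F p

∣∪∣-disjoint : ∀ {n} (E F X : Subset n) → X ⊆ᵇ (E ─ F) ≡ true → ∣ X ∪ F ∣ ≡ ∣ X ∣ + ∣ F ∣
∣∪∣-disjoint []      []          []          _ = refl
∣∪∣-disjoint (e ∷ E) (true ∷ F)  (false ∷ X) p = trans (cong suc (∣∪∣-disjoint E F X p)) (sym (ℕₚ.+-suc _ _))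
∣∪∣-disjoint (e ∷ E) (false ∷ F) (true ∷ X)  p = cong suc (∣∪∣-disjoint E F X (∧-trueʳ {e} p))
∣∪∣-disjoint (e ∷ E) (false ∷ F) (false ∷ X) p = ∣∪∣-disjoint E F X p

─-⊆ᵇ : ∀ {n} (E F : Subset n) → (E ─ F) ⊆ᵇ E ≡ true
─-⊆ᵇ []          []          = refl
─-⊆ᵇ (e ∷ E)     (true ∷ F)  = ─-⊆ᵇ E F
─-⊆ᵇ (true ∷ E)  (false ∷ F) = ─-⊆ᵇ E F
─-⊆ᵇ (false ∷ E) (false ∷ F) = ─-⊆ᵇ E F

∈-allSubsets : ∀ {n} (X : Subset n) → X ∈ˡ allSubsets n
∈-allSubsets []          = here refl
∈-allSubsets (true ∷ X)  = ∈-++⁺ˡ (∈-map⁺ (true ∷_) (∈-allSubsets X))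
∈-allSubsets (false ∷ X) = ∈-++⁺ʳ _ (∈-map⁺ (false ∷_) (∈-allSubsets X))

subsetSum : ∀ {n} → (Subset n → ℤ) → ℤ
subsetSum {n} f = sumℤ (map f (allSubsets n))

sumℤ-++ : ∀ xs ys → sumℤ (xs ++ ys) ≡ sumℤ xs ℤ.+ sumℤ ys
sumℤ-++ []       ys = sym (ℤₚ.+-identityˡ _)
sumℤ-++ (x ∷ xs) ys = trans (cong (λ z → x ℤ.+ z) (sumℤ-++ xs ys)) (sym (ℤₚ.+-assoc x _ _))

sumℤ-map-0 : ∀ {A : Set} (f : A → ℤ) xs → (∀ x → f x ≡ + 0) → sumℤ (map f xs) ≡ + 0
sumℤ-map-0 f []       _ = refl
sumℤ-map-0 f (x ∷ xs) h rewrite h x | sumℤ-map-0 f xs h = refl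

subsetSum-cong : ∀ {n} {f g : Subset n → ℤ} → (∀ X → f X ≡ g X) → subsetSum f ≡ subsetSum g
subsetSum-cong {n} h = cong sumℤ (map-cong h (allSubsets n))

subsetSum-suc : ∀ {n} (f : Subset (suc n) → ℤ) →
  subsetSum f ≡ subsetSum (f ∘ (true ∷_)) ℤ.+ subsetSum (f ∘ (false ∷_))
subsetSum-suc {n} f
  rewrite map-++ f (map (true ∷_) (allSubsets n)) (map (false ∷_) (allSubsets n))
  | sumℤ-++ (map f (map (true ∷_) (allSubsets n))) (map f (map (false ∷_) (allSubsets n)))
  | sym (map-∘ {g = f} {f = true ∷_} (allSubsets n)) | sym (map-∘ {g = f} {f = false ∷_} (allSubsets n)) = refl

-- Each element of G is either left out or taken, and taking it shifts the size by one: exactly the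
-- two summands of the recursion for `binomSum`.
subsetSum-size : ∀ {n} (g : ℕ → ℤ) (G : Subset n) →
  subsetSum (λ X → if X ⊆ᵇ G then g ∣ X ∣ else + 0) ≡ binomSum g ∣ G ∣
subsetSum-size g [] = ℤₚ.+-identityʳ (g 0)
subsetSum-size {suc n} g (true ∷ G) = trans (subsetSum-suc {n} _)
  (trans (cong₂ ℤ._+_ (subsetSum-size (g ∘ suc) G) (subsetSum-size g G))
    (ℤₚ.+-comm (binomSum (g ∘ suc) (∣ G ∣)) (binomSum g (∣ G ∣))))
subsetSum-size {suc n} g (false ∷ G) = trans (subsetSum-suc {n} _)
  (trans (cong₂ ℤ._+_ (sumℤ-map-0 _ (allSubsets n) (λ _ → refl)) (subsetSum-size g G)) (ℤₚ.+-identityˡ _))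

subsetSum-by-size : ∀ {n} {f : Subset n → ℤ} (g : ℕ → ℤ) (G : Subset n) →
  (∀ X → X ⊆ᵇ G ≡ true → f X ≡ g ∣ X ∣) → (∀ X → X ⊆ᵇ G ≡ false → f X ≡ + 0) →
  subsetSum f ≡ binomSum g ∣ G ∣
subsetSum-by-size {n} {f} g G inside outside = trans (subsetSum-cong pointwise) (subsetSum-size g G)
  where
  pointwise : ∀ X → f X ≡ (if X ⊆ᵇ G then g ∣ X ∣ else + 0)
  pointwise X with X ⊆ᵇ G in eq
  ... | true  = inside X eq
  ... | false = outside X eq

sumℤ-filter : ∀ {A : Set} (b : A → Bool) (f : A → ℤ) xs →
  sumℤ (map f (foldr (λ x acc → if b x then x ∷ acc else acc) [] xs)) ≡
  sumℤ (map (λ x → if b x then f x else + 0) xs)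
sumℤ-filter b f [] = refl
sumℤ-filter b f (x ∷ xs) with b x
... | true  = cong (λ z → f x ℤ.+ z) (sumℤ-filter b f xs)
... | false = trans (sumℤ-filter b f xs) (sym (ℤₚ.+-identityˡ _))

foldr-⊔-≤ : ∀ {A : Set} (b : A → Bool) (f : A → ℕ) {u} xs → (∀ x → b x ≡ true → f x ≤ u) →
  foldr (λ x acc → if b x then f x ⊔ acc else acc) 0 xs ≤ u
foldr-⊔-≤ b f []       h = z≤n
foldr-⊔-≤ b f (x ∷ xs) h with b x in eq
... | true  = ℕₚ.⊔-lub (h x eq) (foldr-⊔-≤ b f xs h)
... | false = foldr-⊔-≤ b f xs h

≤-foldr-⊔ : ∀ {A : Set} (b : A → Bool) (f : A → ℕ) {x} xs → x ∈ˡ xs → b x ≡ true →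
  f x ≤ foldr (λ x acc → if b x then f x ⊔ acc else acc) 0 xs
≤-foldr-⊔ b f (x ∷ xs) (here refl) p rewrite p = ℕₚ.m≤m⊔n (f x) _
≤-foldr-⊔ b f (y ∷ xs) (there i)   p with b y
... | true  = ℕₚ.≤-trans (≤-foldr-⊔ b f xs i p) (ℕₚ.m≤n⊔m (f y) _)
... | false = ≤-foldr-⊔ b f xs i p

-- Uniform matroids and their minors

-- Pointwise, so that minors qualify without function extensionality. The bound d may exceed the
-- size of E, in which case the rank is smaller than d.
IsUniform : ∀ {n} → Subset n → (Subset n → Bool) → ℕ → Set
IsUniform E Ind d = ∀ X → Ind X ≡ (X ⊆ᵇ E) ∧ (∣ X ∣ ≤ᵇ d)

uniform-intro : ∀ {n} {E : Subset n} {Ind d} → IsUniform E Ind d → ∀ X →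
  X ⊆ᵇ E ≡ true → ∣ X ∣ ≤ d → Ind X ≡ true
uniform-intro unif X p q rewrite unif X | p = ≤⇒≤ᵇ≡true q

uniform-⊆ : ∀ {n} {E : Subset n} {Ind d} → IsUniform E Ind d → ∀ X → Ind X ≡ true → X ⊆ᵇ E ≡ true
uniform-⊆ unif X p = ∧-trueˡ (trans (sym (unif X)) p)

uniform-size : ∀ {n} {E : Subset n} {Ind d} → IsUniform E Ind d → ∀ X → Ind X ≡ true → ∣ X ∣ ≤ d
uniform-size {E = E} {d = d} unif X p =
  ℕₚ.≤ᵇ⇒≤ ∣ X ∣ d (≡true→T (∧-trueʳ {X ⊆ᵇ E} (trans (sym (unif X)) p)))

lookup-false⇒∉ : ∀ {n} {X : Subset n} {x} → lookup X x ≡ false → x ∉ X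
lookup-false⇒∉ p h with trans (sym p) ([]=⇒lookup h)
... | ()

uniform-isMatroid : ∀ {n} {E : Subset n} {Ind d} → IsUniform E Ind d → IsMatroid E Ind
uniform-isMatroid {n} {E} {Ind} {d} unif = record
  { ind-⊆E    = λ X t → ⊆ᵇ⇒⊆ X E (uniform-⊆ {Ind = Ind} unif X (T→≡true t))
  ; ind-empty = ≡true→T (uniform-intro {Ind = Ind} unif ⊥ (⊥-⊆ᵇ E) (ℕₚ.≤-trans (ℕₚ.≤-reflexive (Subsetₚ.∣⊥∣≡0 n)) z≤n))
  ; ind-down  = down
  ; ind-aug   = aug
  }
  where
  down : ∀ X Y → X ⊆ Y → T (Ind Y) → T (Ind X)
  down X Y X⊆Y t = ≡true→T (uniform-intro {Ind = Ind} unif X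
    (⊆ᵇ-trans X Y E X⊆ᵇY (uniform-⊆ {Ind = Ind} unif Y (T→≡true t)))
    (ℕₚ.≤-trans (⊆ᵇ⇒∣∣≤ X Y X⊆ᵇY) (uniform-size {Ind = Ind} unif Y (T→≡true t))))
    where X⊆ᵇY = ⊆⇒⊆ᵇ X Y X⊆Y
  aug : ∀ X Y → T (Ind X) → T (Ind Y) → ∣ X ∣ < ∣ Y ∣ → ∃ λ x → x ∈ Y × x ∉ X × T (Ind (X ∪ ⁅ x ⁆))
  aug X Y tX tY X<Y with element-outside X Y X<Y
  ... | x , x∈Y , x∉X = x , lookup⇒[]= x Y x∈Y , lookup-false⇒∉ x∉X ,
    ≡true→T (uniform-intro {Ind = Ind} unif (X ∪ ⁅ x ⁆)
      (∪-⊆ᵇ X ⁅ x ⁆ E (uniform-⊆ {Ind = Ind} unif X (T→≡true tX))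
        (⊆ᵇ-trans ⁅ x ⁆ Y E (⁅⁆-⊆ᵇ x Y x∈Y) (uniform-⊆ {Ind = Ind} unif Y (T→≡true tY))))
      (ℕₚ.≤-trans (ℕₚ.≤-reflexive (∣∪⁅⁆∣ X x x∉X)) (ℕₚ.≤-trans X<Y (uniform-size {Ind = Ind} unif Y (T→≡true tY)))))

uniform-rank : ∀ {n} {E : Subset n} {Ind d} → IsUniform E Ind d → ∀ X → X ⊆ᵇ E ≡ true →
  rank E Ind X ≡ ∣ X ∣ ⊓ d
uniform-rank {n} {E} {Ind} {d} unif X X⊆E = ℕₚ.≤-antisym
  (foldr-⊔-≤ _ ∣_∣ (allSubsets n) (λ Y p → ℕₚ.⊓-glb
    (⊆ᵇ⇒∣∣≤ Y X (∧-trueʳ {Ind Y} p)) (uniform-size {Ind = Ind} unif Y (∧-trueˡ p))))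
  (attained (subset-of-size (∣ X ∣ ⊓ d) X (ℕₚ.m⊓n≤m _ d)))
  where
  attained : (∃ λ Y → Y ⊆ᵇ X ≡ true × ∣ Y ∣ ≡ ∣ X ∣ ⊓ d) → ∣ X ∣ ⊓ d ≤ rank E Ind X
  attained (Y , Y⊆X , size) = subst (_≤ rank E Ind X) size
    (≤-foldr-⊔ (λ Y → Ind Y ∧ (Y ⊆ᵇ X)) ∣_∣ (allSubsets n) (∈-allSubsets Y)
      (cong₂ _∧_ (uniform-intro {Ind = Ind} unif Y (⊆ᵇ-trans Y X E Y⊆X X⊆E)
        (ℕₚ.≤-trans (ℕₚ.≤-reflexive size) (ℕₚ.m⊓n≤n _ d))) Y⊆X))

uniform-rk : ∀ {n} {E : Subset n} {Ind d} → IsUniform E Ind d → d ≤ ∣ E ∣ → rk E Ind ≡ d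
uniform-rk {E = E} unif d≤E = trans (uniform-rank unif E (⊆ᵇ-refl E)) (ℕₚ.m≥n⇒m⊓n≡n d≤E)

-- The minimum lets one statement serve both a proper flat, where it equals ∣F∣ and the restriction
-- is Boolean, and F = E.
uniform-restr : ∀ {n} {E : Subset n} {Ind d} → IsUniform E Ind d → ∀ F → F ⊆ᵇ E ≡ true →
  IsUniform F (restrInd E Ind F) (∣ F ∣ ⊓ d)
uniform-restr {E = E} {Ind} {d} unif F F⊆E X with X ⊆ᵇ F in eq
... | false = Boolₚ.∧-zeroʳ (Ind X)
... | true rewrite unif X | ⊆ᵇ-trans X F E eq F⊆E with ∣ X ∣ ℕ.≤? d
...   | yes p rewrite ≤⇒≤ᵇ≡true p = sym (≤⇒≤ᵇ≡true (ℕₚ.⊓-glb (⊆ᵇ⇒∣∣≤ X F eq) p))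
...   | no ¬p rewrite >⇒≤ᵇ≡false (ℕₚ.≰⇒> ¬p) = sym (>⇒≤ᵇ≡false (ℕₚ.≤-<-trans (ℕₚ.m⊓n≤n ∣ F ∣ d) (ℕₚ.≰⇒> ¬p)))

-- With ∣F∣ ≤ d the set F has rank ∣F∣. A set X disjoint from F then raises the rank by its full
-- size exactly when ∣X∣ + ∣F∣ ≤ d.
uniform-contr : ∀ {n} {E : Subset n} {Ind d} → IsUniform E Ind d → ∀ F → F ⊆ᵇ E ≡ true → ∣ F ∣ ≤ d →
  IsUniform (E ─ F) (contrInd E Ind F) (d ∸ ∣ F ∣)
uniform-contr {E = E} {Ind} {d} unif F F⊆E F≤d X with X ⊆ᵇ (E ─ F) in eq
... | false = refl
... | true rewrite uniform-rank {Ind = Ind} unif (X ∪ F) (∪-⊆ᵇ X F E (⊆ᵇ-trans X (E ─ F) E eq (─-⊆ᵇ E F)) F⊆E)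
                 | uniform-rank {Ind = Ind} unif F F⊆E | ∣∪∣-disjoint E F X eq | ℕₚ.m≤n⇒m⊓n≡m F≤d
      with ∣ X ∣ + ∣ F ∣ ℕ.≤? d
...   | yes p rewrite ℕₚ.m≤n⇒m⊓n≡m p | ≡⇒≡ᵇ≡true {∣ X ∣ + ∣ F ∣} refl = sym (≤⇒≤ᵇ≡true (ℕₚ.m+n≤o⇒m≤o∸n ∣ X ∣ p))
...   | no ¬p = trans (≢⇒≡ᵇ≡false {(∣ X ∣ + ∣ F ∣) ⊓ d}
                        (λ q → ¬p (ℕₚ.≤-trans (ℕₚ.≤-reflexive (sym q)) (ℕₚ.m⊓n≤n (∣ X ∣ + ∣ F ∣) d))))
                      (sym (>⇒≤ᵇ≡false (ℕₚ.≰⇒> (λ q → ¬p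
                        (ℕₚ.≤-trans (ℕₚ.+-monoˡ-≤ ∣ F ∣ q) (ℕₚ.≤-reflexive (ℕₚ.m∸n+n≡m F≤d)))))))

-- Flats, Möbius function and characteristic polynomial

allᵇ-true : ∀ {A : Set} (p : A → Bool) xs → (∀ x → p x ≡ true) → allᵇ p xs ≡ true
allᵇ-true p []       h = refl
allᵇ-true p (x ∷ xs) h rewrite h x = allᵇ-true p xs h

allᵇ-false : ∀ {A : Set} (p : A → Bool) {x} xs → x ∈ˡ xs → p x ≡ false → allᵇ p xs ≡ false
allᵇ-false p (x ∷ xs) (here refl) e rewrite e = refl
allᵇ-false p (y ∷ xs) (there i)   e rewrite allᵇ-false p xs i e = Boolₚ.∧-zeroʳ (p y)

∪⁅⁆-⊆ᵇ : ∀ {n} (F E : Subset n) x → F ⊆ᵇ E ≡ true → lookup E x ≡ true → (F ∪ ⁅ x ⁆) ⊆ᵇ E ≡ true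
∪⁅⁆-⊆ᵇ F E x F⊆E x∈E = ∪-⊆ᵇ F ⁅ x ⁆ E F⊆E (⁅⁆-⊆ᵇ x E x∈E)

isFlat-small : ∀ {n} {E : Subset n} {Ind d} → IsUniform E Ind d → ∀ F → F ⊆ᵇ E ≡ true → ∣ F ∣ < d →
  isFlat E Ind F ≡ true
isFlat-small {n} {E} {Ind} {d} unif F F⊆E F<d rewrite F⊆E = allᵇ-true _ (allFin n) step
  where
  step : ∀ x → not (lookup E x ∧ not (lookup F x)) ∨ (rank E Ind F <ᵇ rank E Ind (F ∪ ⁅ x ⁆)) ≡ true
  step x with lookup E x in x∈E | lookup F x in x∈F
  ... | false | _    = refl
  ... | true  | true = refl
  ... | true  | false
    rewrite uniform-rank {Ind = Ind} unif F F⊆E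
          | uniform-rank {Ind = Ind} unif (F ∪ ⁅ x ⁆) (∪⁅⁆-⊆ᵇ F E x F⊆E x∈E)
          | ∣∪⁅⁆∣ F x x∈F
          | ℕₚ.m≤n⇒m⊓n≡m F<d | ℕₚ.m≤n⇒m⊓n≡m (ℕₚ.<⇒≤ F<d) = <⇒<ᵇ≡true (ℕₚ.n<1+n ∣ F ∣)

isFlat-top : ∀ {n} (E : Subset n) Ind → isFlat E Ind E ≡ true
isFlat-top {n} E Ind rewrite ⊆ᵇ-refl E = allᵇ-true _ (allFin n) step
  where
  step : ∀ x → not (lookup E x ∧ not (lookup E x)) ∨ (rank E Ind E <ᵇ rank E Ind (E ∪ ⁅ x ⁆)) ≡ true
  step x with lookup E x
  ... | false = refl
  ... | true  = refl

-- By size, some element of E lies outside F; adding it cannot raise the rank, which is already d.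
isFlat-large : ∀ {n} {E : Subset n} {Ind d} → IsUniform E Ind d → ∀ F → F ⊆ᵇ E ≡ true → d ≤ ∣ F ∣ →
  ∣ F ∣ < ∣ E ∣ → isFlat E Ind F ≡ false
isFlat-large {n} {E} {Ind} {d} unif F F⊆E d≤F F<E with element-outside F E F<E
... | x , x∈E , x∉F = cong₂ _∧_ F⊆E (allᵇ-false separates (allFin n) (∈-allFin x) step)
  where
  separates : Fin n → Bool
  separates y = not (lookup E y ∧ not (lookup F y)) ∨ (rank E Ind F <ᵇ rank E Ind (F ∪ ⁅ y ⁆))
  step : separates x ≡ false
  step
    rewrite x∈E | x∉F
          | uniform-rank {Ind = Ind} unif F F⊆E
          | uniform-rank {Ind = Ind} unif (F ∪ ⁅ x ⁆) (∪⁅⁆-⊆ᵇ F E x F⊆E x∈E)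
          | ∣∪⁅⁆∣ F x x∉F
          | ℕₚ.m≥n⇒m⊓n≡n d≤F | ℕₚ.m≥n⇒m⊓n≡n (ℕₚ.m≤n⇒m≤1+n d≤F) = ≥⇒<ᵇ≡false {d} ℕₚ.≤-refl

isFlat-⊈ : ∀ {n} (E F : Subset n) Ind → F ⊆ᵇ E ≡ false → isFlat E Ind F ≡ false
isFlat-⊈ E F Ind F⊈E rewrite F⊈E = refl

-- Positive rank excludes loops, so the minimal flat from which χ measures μ is the empty set.
cl-⊥ : ∀ {n} {E : Subset n} {Ind d} → IsUniform E Ind d → 0 < d → cl E Ind ⊥ ≡ ⊥
cl-⊥ {n} {E} {Ind} {d} unif 0<d = trans
  (tabulate-cong (λ x → trans (loopless x) (sym (lookup-replicate x false))))
  (tabulate∘lookup ⊥)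
  where
  loopless : ∀ x → lookup E x ∧ (rank E Ind (⊥ ∪ ⁅ x ⁆) ≡ᵇ rank E Ind ⊥) ≡ false
  loopless x with lookup E x in x∈E
  ... | false = refl
  ... | true
    rewrite uniform-rank {Ind = Ind} unif ⊥ (⊥-⊆ᵇ E)
          | uniform-rank {Ind = Ind} unif (⊥ ∪ ⁅ x ⁆) (∪⁅⁆-⊆ᵇ ⊥ E x (⊥-⊆ᵇ E) x∈E)
          | ∣∪⁅⁆∣ ⊥ x (lookup-replicate x false) | Subsetₚ.∣⊥∣≡0 n | ℕₚ.m≤n⇒m⊓n≡m 0<d = refl

-- The value of μ(∅, G) in a uniform matroid, for |G| = n and rk G = r.
möbius : ℕ → ℕ → ℤ
möbius r zero    = + 1
möbius r (suc n) = - altSum r (suc n)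

möbius-suc : ∀ r n → möbius (suc r) (suc n) ≡ sgn (suc r) ℤ.* binom n r
möbius-suc r n rewrite altSum-suc r n | sgn-suc r = ℤₚ.neg-distribˡ-* (sgn r) (binom n r)

-- The Boolean case, which gives the Möbius value of every proper flat.
möbius-diagonal : ∀ n → möbius n n ≡ sgn n
möbius-diagonal zero    = refl
möbius-diagonal (suc n) rewrite möbius-suc n n | binom-n-n n = ℤₚ.*-identityʳ _

if-true : ∀ {A : Set} {b} {x y : A} → b ≡ true → (if b then x else y) ≡ x
if-true refl = refl

if-false : ∀ {A : Set} {b} {x y : A} → b ≡ false → (if b then x else y) ≡ y
if-false refl = refl

if-idem : ∀ {A : Set} b {x : A} → (if b then x else x) ≡ x
if-idem true  = refl
if-idem false = refl

-- Induction on the fuel. The flats strictly inside G are its subsets with fewer than min(∣G∣, d)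
-- elements. Their lower intervals are Boolean, so each contributes (-1)^∣H∣ and the recursion sums
-- to `altSum`.
uniform-μ′ : ∀ {n} {E : Subset n} {Ind d} → IsUniform E Ind d → ∀ k G → G ⊆ᵇ E ≡ true → ∣ G ∣ < k →
  μ′ E Ind k ⊥ G ≡ möbius (∣ G ∣ ⊓ d) ∣ G ∣
uniform-μ′ {n} {E} {Ind} {d} unif (suc k) G G⊆E (s≤s G≤k) = trans unfold cases
  where
  term : Subset n → ℤ
  term H = if (⊥ ⊆ᵇ H) ∧ (H ⊆ᵇ G) ∧ not (H ≟ˢ G) then μ′ E Ind k ⊥ H else + 0
  below-G : ∀ H → H ⊆ᵇ G ≡ true → ∣ H ∣ < ∣ G ∣ → term H ≡ μ′ E Ind k ⊥ H
  below-G H H⊆G H<G = if-true (cong₂ _∧_ (⊥-⊆ᵇ H) (cong₂ _∧_ H⊆G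
    (cong not (trans (≟ˢ-⊆ᵇ H G H⊆G) (≢⇒≡ᵇ≡false (ℕₚ.<⇒≢ H<G))))))
  at-G : ∀ H → H ⊆ᵇ G ≡ true → ∣ G ∣ ≤ ∣ H ∣ → term H ≡ + 0
  at-G H H⊆G G≤H = if-false (cong₂ _∧_ (⊥-⊆ᵇ H) (cong₂ _∧_ H⊆G
    (cong not (trans (≟ˢ-⊆ᵇ H G H⊆G) (≡⇒≡ᵇ≡true (ℕₚ.≤-antisym (⊆ᵇ⇒∣∣≤ H G H⊆G) G≤H))))))
  r : ℕ
  r = ∣ G ∣ ⊓ d
  inside : ∀ H → H ⊆ᵇ G ≡ true → (if isFlat E Ind H then term H else + 0) ≡ below r sgn ∣ H ∣
  inside H H⊆G with ∣ H ∣ ℕ.<? r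
  ... | yes H<r = begin
    (if isFlat E Ind H then term H else + 0)
      ≡⟨ if-true (isFlat-small {Ind = Ind} unif H H⊆E H<d) ⟩
    term H
      ≡⟨ below-G H H⊆G H<G ⟩
    μ′ E Ind k ⊥ H
      ≡⟨ uniform-μ′ unif k H H⊆E (ℕₚ.<-≤-trans H<G G≤k) ⟩
    möbius (∣ H ∣ ⊓ d) (∣ H ∣)
      ≡⟨ cong (λ s → möbius s (∣ H ∣)) (ℕₚ.m≤n⇒m⊓n≡m (ℕₚ.<⇒≤ H<d)) ⟩
    möbius (∣ H ∣) (∣ H ∣)
      ≡⟨ möbius-diagonal (∣ H ∣) ⟩
    sgn (∣ H ∣)
      ≡⟨ below-< sgn H<r ⟨
    below r sgn (∣ H ∣) ∎
    where
    open ≡-Reasoning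
    H⊆E = ⊆ᵇ-trans H G E H⊆G G⊆E
    H<G = ℕₚ.<-≤-trans H<r (ℕₚ.m⊓n≤m (∣ G ∣) d)
    H<d = ℕₚ.<-≤-trans H<r (ℕₚ.m⊓n≤n (∣ G ∣) d)
  -- Either H has the size of G and is excluded by the condition H ≠ G, or d ≤ ∣H∣ < ∣G∣ and H is
  -- not a flat.
  ... | no H≮r = trans vanish (sym (below-≥ sgn (ℕₚ.≮⇒≥ H≮r)))
    where
    vanish : (if isFlat E Ind H then term H else + 0) ≡ + 0
    vanish with ∣ H ∣ ℕ.<? ∣ G ∣
    ... | no H≮G = trans (cong (λ z → if isFlat E Ind H then z else + 0) (at-G H H⊆G (ℕₚ.≮⇒≥ H≮G)))
                         (if-idem (isFlat E Ind H))
    ... | yes H<G = if-false (isFlat-large {Ind = Ind} unif H (⊆ᵇ-trans H G E H⊆G G⊆E)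
      (ℕₚ.≮⇒≥ (λ H<d → H≮r (ℕₚ.⊓-glb H<G H<d))) (ℕₚ.<-≤-trans H<G (⊆ᵇ⇒∣∣≤ G E G⊆E)))
  outside : ∀ H → H ⊆ᵇ G ≡ false → (if isFlat E Ind H then term H else + 0) ≡ + 0
  outside H H⊈G = trans
    (cong (λ z → if isFlat E Ind H then z else + 0)
      (if-false (trans (cong (λ b → (⊥ ⊆ᵇ H) ∧ b ∧ not (H ≟ˢ G)) H⊈G) (Boolₚ.∧-zeroʳ (⊥ ⊆ᵇ H)))))
    (if-idem (isFlat E Ind H))
  S : ℤ
  S = sumℤ (map term (flats E Ind))
  S≡altSum : S ≡ altSum r ∣ G ∣
  S≡altSum = trans (sumℤ-filter (isFlat E Ind) term (allSubsets n))
                   (subsetSum-by-size (below r sgn) G inside outside)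
  unfold : μ′ E Ind (suc k) ⊥ G ≡ (if ∣ G ∣ ≡ᵇ 0 then + 1 else - altSum r ∣ G ∣)
  unfold = begin
    (if ⊥ ≟ˢ G then + 1 else if ⊥ ⊆ᵇ G then - S else + 0)
      ≡⟨ cong (λ z → if ⊥ ≟ˢ G then + 1 else z) (if-true (⊥-⊆ᵇ G)) ⟩
    (if ⊥ ≟ˢ G then + 1 else - S)
      ≡⟨ cong (λ z → if ⊥ ≟ˢ G then + 1 else - z) S≡altSum ⟩
    (if ⊥ ≟ˢ G then + 1 else - altSum r (∣ G ∣))
      ≡⟨ cong (λ b → if b then + 1 else - altSum r (∣ G ∣))
           (trans (≟ˢ-⊆ᵇ ⊥ G (⊥-⊆ᵇ G)) (trans (cong (_≡ᵇ (∣ G ∣)) (Subsetₚ.∣⊥∣≡0 n)) (0≡ᵇ (∣ G ∣)))) ⟩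
    (if ∣ G ∣ ≡ᵇ 0 then + 1 else - altSum r (∣ G ∣)) ∎
    where
    open ≡-Reasoning
    0≡ᵇ : ∀ m → (0 ≡ᵇ m) ≡ (m ≡ᵇ 0)
    0≡ᵇ zero    = refl
    0≡ᵇ (suc m) = refl
  cases : (if ∣ G ∣ ≡ᵇ 0 then + 1 else - altSum r ∣ G ∣) ≡ möbius r ∣ G ∣
  cases with ∣ G ∣
  ... | zero  = refl
  ... | suc _ = refl

-- The hypotheses prescribe g on three ranges of sizes: proper flats, subsets that are not flats,
-- and the top flat. In both applications g is a point mass, since the flats of one rank all have
-- one size.
uniform-χ : ∀ {n} {E : Subset n} {Ind d} → IsUniform E Ind d → 0 < d → d ≤ ∣ E ∣ → ∀ e (g : ℕ → ℤ) →
  (∀ k → k < d → (if (d ∸ k) ≡ᵇ e then sgn k else + 0) ≡ g k) →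
  (∀ k → d ≤ k → k < ∣ E ∣ → g k ≡ + 0) →
  (if 0 ≡ᵇ e then möbius d ∣ E ∣ else + 0) ≡ g ∣ E ∣ →
  χ E Ind e ≡ binomSum g ∣ E ∣
uniform-χ {n} {E} {Ind} {d} unif 0<d d≤E e g small middle top = trans
  (sumℤ-filter (isFlat E Ind) term (allSubsets n)) (subsetSum-by-size g E inside outside)
  where
  open ≡-Reasoning
  term : Subset n → ℤ
  term F = if (rk E Ind ∸ rank E Ind F) ≡ᵇ e then μ E Ind (cl E Ind ⊥) F else + 0
  term-value : ∀ F → F ⊆ᵇ E ≡ true →
    term F ≡ (if (d ∸ ∣ F ∣ ⊓ d) ≡ᵇ e then möbius (∣ F ∣ ⊓ d) ∣ F ∣ else + 0)
  term-value F F⊆E = cong₂ (λ c v → if c ≡ᵇ e then v else + 0)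
    (cong₂ _∸_ (uniform-rk {Ind = Ind} unif d≤E) (uniform-rank {Ind = Ind} unif F F⊆E))
    (trans (cong (λ Z → μ E Ind Z F) (cl-⊥ {Ind = Ind} unif 0<d))
           (uniform-μ′ {Ind = Ind} unif (suc (∣ F ∣)) F F⊆E (ℕₚ.n<1+n (∣ F ∣))))
  inside : ∀ F → F ⊆ᵇ E ≡ true → (if isFlat E Ind F then term F else + 0) ≡ g ∣ F ∣
  inside F F⊆E with ∣ F ∣ ℕ.<? d | ∣ F ∣ ℕ.<? ∣ E ∣
  ... | yes F<d | _ = begin
    (if isFlat E Ind F then term F else + 0)
      ≡⟨ if-true (isFlat-small {Ind = Ind} unif F F⊆E F<d) ⟩
    term F
      ≡⟨ term-value F F⊆E ⟩
    (if (d ∸ ∣ F ∣ ⊓ d) ≡ᵇ e then möbius (∣ F ∣ ⊓ d) (∣ F ∣) else + 0)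
      ≡⟨ cong (λ r → if (d ∸ r) ≡ᵇ e then möbius r (∣ F ∣) else + 0) (ℕₚ.m≤n⇒m⊓n≡m (ℕₚ.<⇒≤ F<d)) ⟩
    (if (d ∸ ∣ F ∣) ≡ᵇ e then möbius (∣ F ∣) (∣ F ∣) else + 0)
      ≡⟨ cong (λ v → if (d ∸ ∣ F ∣) ≡ᵇ e then v else + 0) (möbius-diagonal (∣ F ∣)) ⟩
    (if (d ∸ ∣ F ∣) ≡ᵇ e then sgn (∣ F ∣) else + 0)
      ≡⟨ small (∣ F ∣) F<d ⟩
    g (∣ F ∣) ∎
  ... | no F≮d | yes F<E = trans (if-false (isFlat-large {Ind = Ind} unif F F⊆E (ℕₚ.≮⇒≥ F≮d) F<E))
                                 (sym (middle (∣ F ∣) (ℕₚ.≮⇒≥ F≮d) F<E))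
  ... | no F≮d | no F≮E rewrite ⊆ᵇ∧∣∣≥⇒≡ F E F⊆E (ℕₚ.≮⇒≥ F≮E) = begin
    (if isFlat E Ind E then term E else + 0)
      ≡⟨ if-true (isFlat-top E Ind) ⟩
    term E
      ≡⟨ term-value E (⊆ᵇ-refl E) ⟩
    (if (d ∸ ∣ E ∣ ⊓ d) ≡ᵇ e then möbius (∣ E ∣ ⊓ d) (∣ E ∣) else + 0)
      ≡⟨ cong (λ r → if (d ∸ r) ≡ᵇ e then möbius r (∣ E ∣) else + 0) (ℕₚ.m≥n⇒m⊓n≡n d≤E) ⟩
    (if (d ∸ d) ≡ᵇ e then möbius d (∣ E ∣) else + 0)
      ≡⟨ cong (λ c → if c ≡ᵇ e then möbius d (∣ E ∣) else + 0) (ℕₚ.n∸n≡0 d) ⟩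
    (if 0 ≡ᵇ e then möbius d (∣ E ∣) else + 0)
      ≡⟨ top ⟩
    g (∣ E ∣) ∎
  outside : ∀ F → F ⊆ᵇ E ≡ false → (if isFlat E Ind F then term F else + 0) ≡ + 0
  outside F F⊈E = if-false (isFlat-⊈ E F Ind F⊈E)

rev-≤ : ∀ r p {i} → i ≤ r → rev r p i ≡ p (r ∸ i)
rev-≤ r p i≤r = if-true (≤⇒≤ᵇ≡true i≤r)

rev-> : ∀ r p {i} → r < i → rev r p i ≡ + 0
rev-> r p r<i = if-false (>⇒≤ᵇ≡false r<i)

-- Reversal moves the contribution of the rank i flats to exponent i. For i < d these are all the
-- i-subsets, each with μ = (-1)^i.
uniform-revχ-< : ∀ {n} {E : Subset n} {Ind d i} → IsUniform E Ind d → d ≤ ∣ E ∣ → i < d →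
  rev (rk E Ind) (χ E Ind) i ≡ sgn i ℤ.* binom ∣ E ∣ i
uniform-revχ-< {E = E} {Ind} {d} {i} unif d≤E i<d = begin
  rev (rk E Ind) (χ E Ind) i
    ≡⟨ cong (λ r → rev r (χ E Ind) i) (uniform-rk {Ind = Ind} unif d≤E) ⟩
  rev d (χ E Ind) i
    ≡⟨ rev-≤ d (χ E Ind) (ℕₚ.<⇒≤ i<d) ⟩
  χ E Ind (d ∸ i)
    ≡⟨ uniform-χ {Ind = Ind} unif (ℕₚ.≤-<-trans z≤n i<d) d≤E (d ∸ i) (pointMass i (sgn i)) small
         (λ k d≤k _ → off-mass (ℕₚ.<⇒≢ (ℕₚ.<-≤-trans i<d d≤k) ∘ sym))
         (trans (if-false (≢⇒≡ᵇ≡false (ℕₚ.<⇒≢ (ℕₚ.m<n⇒0<n∸m i<d))))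
                (sym (off-mass (ℕₚ.<⇒≢ (ℕₚ.<-≤-trans i<d d≤E) ∘ sym)))) ⟩
  binomSum (pointMass i (sgn i)) (∣ E ∣)
    ≡⟨ binomSum-pointMass i (sgn i) (∣ E ∣) ⟩
  binom (∣ E ∣) i ℤ.* sgn i
    ≡⟨ ℤₚ.*-comm (binom (∣ E ∣) i) (sgn i) ⟩
  sgn i ℤ.* binom (∣ E ∣) i ∎
  where
  open ≡-Reasoning
  off-mass : ∀ {k} → k ≢ i → pointMass i (sgn i) k ≡ + 0
  off-mass k≢i = if-false (≢⇒≡ᵇ≡false k≢i)
  small : ∀ k → k < d → (if (d ∸ k) ≡ᵇ (d ∸ i) then sgn k else + 0) ≡ pointMass i (sgn i) k
  small k k<d with k ℕ.≟ i
  ... | yes refl = trans (if-true (≡⇒≡ᵇ≡true {d ∸ k} refl)) (sym (if-true (≡⇒≡ᵇ≡true {k} refl)))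
  ... | no k≢i = trans
    (if-false (≢⇒≡ᵇ≡false (λ eq → k≢i (ℕₚ.∸-cancelˡ-≡ (ℕₚ.<⇒≤ k<d) (ℕₚ.<⇒≤ i<d) eq))))
    (sym (off-mass k≢i))

uniform-revχ-top : ∀ {n} {E : Subset n} {Ind d} → IsUniform E Ind d → 0 < d → d ≤ ∣ E ∣ →
  rev (rk E Ind) (χ E Ind) d ≡ möbius d ∣ E ∣
uniform-revχ-top {E = E} {Ind} {d} unif 0<d d≤E = begin
  rev (rk E Ind) (χ E Ind) d
    ≡⟨ cong (λ r → rev r (χ E Ind) d) (uniform-rk {Ind = Ind} unif d≤E) ⟩
  rev d (χ E Ind) d
    ≡⟨ rev-≤ d (χ E Ind) ℕₚ.≤-refl ⟩
  χ E Ind (d ∸ d)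
    ≡⟨ cong (χ E Ind) (ℕₚ.n∸n≡0 d) ⟩
  χ E Ind 0
    ≡⟨ uniform-χ {Ind = Ind} unif 0<d d≤E 0 (pointMass (∣ E ∣) (möbius d (∣ E ∣)))
         (λ k k<d → trans (if-false (≢⇒≡ᵇ≡false (ℕₚ.<⇒≢ (ℕₚ.m<n⇒0<n∸m k<d) ∘ sym)))
                          (sym (off-mass (ℕₚ.<⇒≢ (ℕₚ.<-≤-trans k<d d≤E)))))
         (λ k _ k<E → off-mass (ℕₚ.<⇒≢ k<E))
         (sym (if-true (≡⇒≡ᵇ≡true {∣ E ∣} refl))) ⟩
  binomSum (pointMass (∣ E ∣) (möbius d (∣ E ∣))) (∣ E ∣)
    ≡⟨ binomSum-pointMass (∣ E ∣) _ (∣ E ∣) ⟩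
  binom (∣ E ∣) (∣ E ∣) ℤ.* möbius d (∣ E ∣)
    ≡⟨ cong (ℤ._* möbius d (∣ E ∣)) (binom-n-n (∣ E ∣)) ⟩
  + 1 ℤ.* möbius d (∣ E ∣)
    ≡⟨ ℤₚ.*-identityˡ _ ⟩
  möbius d (∣ E ∣) ∎
  where
  open ≡-Reasoning
  off-mass : ∀ {k} → k ≢ ∣ E ∣ → pointMass (∣ E ∣) (möbius d (∣ E ∣)) k ≡ + 0
  off-mass k≢E = if-false (≢⇒≡ᵇ≡false k≢E)

uniform-revχ-> : ∀ {n} {E : Subset n} {Ind d i} → IsUniform E Ind d → d ≤ ∣ E ∣ → d < i →
  rev (rk E Ind) (χ E Ind) i ≡ + 0
uniform-revχ-> {E = E} {Ind} {d} {i} unif d≤E d<i = trans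
  (cong (λ r → rev r (χ E Ind) i) (uniform-rk {Ind = Ind} unif d≤E)) (rev-> d (χ E Ind) d<i)

-- Inverse Kazhdan–Lusztig polynomials

*ᵖ-identityˡ : ∀ p q → p ≈ᵖ onePoly → ∀ k → (p *ᵖ q) k ≡ q k
*ᵖ-identityˡ p q p≈1 k = begin
  p 0 ℤ.* q k ℤ.+ sumℤ (map (λ i → p i ℤ.* q (k ∸ i)) (applyUpTo suc k))
    ≡⟨ cong₂ ℤ._+_ (cong (ℤ._* q k) (p≈1 0)) higher ⟩
  + 1 ℤ.* q k ℤ.+ + 0
    ≡⟨ ℤₚ.+-identityʳ _ ⟩
  + 1 ℤ.* q k
    ≡⟨ ℤₚ.*-identityˡ (q k) ⟩
  q k ∎
  where
  open ≡-Reasoning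
  higher : sumℤ (map (λ i → p i ℤ.* q (k ∸ i)) (applyUpTo suc k)) ≡ + 0
  higher rewrite map-applyUpTo suc (λ i → p i ℤ.* q (k ∸ i)) k
               | sym (map-applyUpTo (λ i → i) (λ i → p (suc i) ℤ.* q (k ∸ suc i)) k) =
    sumℤ-map-0 _ (upTo k) (λ i → cong (ℤ._* q (k ∸ suc i)) (p≈1 (suc i)))

-- Reversal at rank 0 leaves a constant, so the product reaches no further than p does. This
-- disposes of the summand of F = E.
*ᵖ-rev-0 : ∀ p q k → (∀ i → k ≤ i → p i ≡ + 0) → (p *ᵖ rev 0 q) k ≡ + 0
*ᵖ-rev-0 p q k p-deg = sumℤ-map-0 _ (upTo (suc k)) vanish
  where
  vanish : ∀ i → p i ℤ.* rev 0 q (k ∸ i) ≡ + 0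
  vanish i with i ℕ.<? k
  ... | yes i<k = trans (cong (p i ℤ.*_) (rev-> 0 q (ℕₚ.m<n⇒0<n∸m i<k))) (ℤₚ.*-zeroʳ (p i))
  ... | no i≮k  = cong (ℤ._* rev 0 q (k ∸ i)) (p-deg i (ℕₚ.≮⇒≥ i≮k))

-- The summand of F = E involves Q at restrInd E Ind E, which agrees with Ind only pointwise, and Q need not
-- be extensional.  It drops out of the coefficient of t^(d−j), 2j < d, because of the degree bound.
module _ (Q : Assignment) (KL : IsInverseKL Q) {n} {E : Subset n} {Ind d} (unif : IsUniform E Ind d)
         (d≤E : d ≤ ∣ E ∣)
         (proper-flats : ∀ F → F ⊆ᵇ E ≡ true → ∣ F ∣ < d → Q n F (restrInd E Ind F) ≈ᵖ onePoly) where

  open IsInverseKL KL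

  -- The contraction by F has rank d - ∣F∣, which bounds the degree of its reversed χ. At exponent d
  -- - j, flats with more than j elements therefore give nothing, those with exactly j give the top
  -- coefficient, a Möbius value, and smaller ones count (d-j)-subsets of their complement.
  -- `binomSum-choose` gathers the latter into one `altSum`.
  uniform-coefficient : ∀ j → 2 ℕ.* j < d →
    sgn d ℤ.* Q n E Ind j ≡
    sgn (d ∸ j) ℤ.* (binom ∣ E ∣ (d ∸ j) ℤ.* altSum j (∣ E ∣ ∸ (d ∸ j)))
      ℤ.+ binom ∣ E ∣ j ℤ.* (sgn j ℤ.* möbius (d ∸ j) (∣ E ∣ ∸ j))
  uniform-coefficient j 2j<d = trans (sym lhs) (trans (recursion n E Ind (uniform-isMatroid {Ind = Ind} unif) i) rhs)
    where
    open ≡-Reasoning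
    N i : ℕ
    N = ∣ E ∣
    i = d ∸ j
    j<d : j < d
    j<d = ℕₚ.≤-<-trans (ℕₚ.m≤m+n j _) 2j<d
    -- This places the exponent i in the range where the degree bound annihilates Q.
    d≤2i : d ≤ 2 ℕ.* i
    d≤2i = ℕₚ.≤-trans (ℕₚ.m+n≤o⇒m≤o∸n d {2 ℕ.* j} {2 ℕ.* d}
        (ℕₚ.≤-trans (ℕₚ.+-monoʳ-≤ d (ℕₚ.<⇒≤ 2j<d)) (ℕₚ.+-monoʳ-≤ d (ℕₚ.m≤m+n d 0))))
                      (ℕₚ.≤-reflexive (sym (ℕₚ.*-distribˡ-∸ 2 d j)))
    rk≡d : rk E Ind ≡ d
    rk≡d = uniform-rk {Ind = Ind} unif d≤E
    lhs : (sgn (rk E Ind) ·ᵖ rev (rk E Ind) (Q n E Ind)) i ≡ sgn d ℤ.* Q n E Ind j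
    lhs = begin
      sgn (rk E Ind) ℤ.* rev (rk E Ind) (Q n E Ind) i
        ≡⟨ cong (λ r → sgn r ℤ.* rev r (Q n E Ind) i) rk≡d ⟩
      sgn d ℤ.* rev d (Q n E Ind) i
        ≡⟨ cong (λ z → sgn d ℤ.* z) (rev-≤ d (Q n E Ind) (ℕₚ.m∸n≤m d j)) ⟩
      sgn d ℤ.* Q n E Ind (d ∸ i)
        ≡⟨ cong (λ k → sgn d ℤ.* Q n E Ind k) (ℕₚ.m∸[m∸n]≡n (ℕₚ.<⇒≤ j<d)) ⟩
      sgn d ℤ.* Q n E Ind j ∎
    revχ : Subset n → Poly
    revχ F = rev (rk (contrE E Ind F) (contrInd E Ind F)) (χ (contrE E Ind F) (contrInd E Ind F))
    summand : Subset n → Poly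
    summand F = sgn (rk (restrE E Ind F) (restrInd E Ind F)) ·ᵖ (Q n (restrE E Ind F) (restrInd E Ind F) *ᵖ revχ F)
    -- The summand as a function of ∣F∣: `g₁` carries the sizes below j, `g₂` the size j.
    g₁ g₂ g : ℕ → ℤ
    g₁ k = sgn i ℤ.* (below j sgn k ℤ.* binom (N ∸ k) i)
    g₂ = pointMass j (sgn j ℤ.* möbius i (N ∸ j))
    g k = g₁ k ℤ.+ g₂ k
    g-<j : ∀ k → k < j → g k ≡ sgn k ℤ.* (sgn i ℤ.* binom (N ∸ k) i)
    g-<j k k<j = trans
      (cong₂ ℤ._+_ (cong (λ z → sgn i ℤ.* (z ℤ.* binom (N ∸ k) i)) (below-< sgn k<j)) (if-false (≢⇒≡ᵇ≡false (ℕₚ.<⇒≢ k<j))))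
      (swap (sgn i) (sgn k) (binom (N ∸ k) i))
      where
      swap : ∀ a b c → a ℤ.* (b ℤ.* c) ℤ.+ + 0 ≡ b ℤ.* (a ℤ.* c)
      swap = solve-∀
    g₁-≥j : ∀ k → j ≤ k → g₁ k ≡ + 0
    g₁-≥j k j≤k = trans (cong (λ z → sgn i ℤ.* (z ℤ.* binom (N ∸ k) i)) (below-≥ sgn j≤k)) (ℤₚ.*-zeroʳ (sgn i))
    g-≡j : g j ≡ sgn j ℤ.* möbius i (N ∸ j)
    g-≡j = trans (cong₂ ℤ._+_ (g₁-≥j j ℕₚ.≤-refl) (if-true (≡⇒≡ᵇ≡true {j} refl))) (ℤₚ.+-identityˡ _)
    g->j : ∀ k → j < k → g k ≡ + 0
    g->j k j<k = cong₂ ℤ._+_ (g₁-≥j k (ℕₚ.<⇒≤ j<k)) (if-false (≢⇒≡ᵇ≡false (ℕₚ.<⇒≢ j<k ∘ sym)))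
    small : ∀ F → F ⊆ᵇ E ≡ true → ∣ F ∣ < d → summand F i ≡ g ∣ F ∣
    small F F⊆E F<d = begin
      sgn (rk F (restrInd E Ind F)) ℤ.* (Q n F (restrInd E Ind F) *ᵖ revχ F) i
        ≡⟨ cong₂ (λ r z → sgn r ℤ.* z) rk-F (*ᵖ-identityˡ (Q n F (restrInd E Ind F)) (revχ F) (proper-flats F F⊆E F<d) i) ⟩
      sgn (∣ F ∣) ℤ.* revχ F i
        ≡⟨ by-size ⟩
      g (∣ F ∣) ∎
      where
      F≤d = ℕₚ.<⇒≤ F<d
      rk-F : rk F (restrInd E Ind F) ≡ ∣ F ∣
      rk-F = trans (uniform-rk {Ind = restrInd E Ind F} (uniform-restr {Ind = Ind} unif F F⊆E) (ℕₚ.m⊓n≤m (∣ F ∣) d)) (ℕₚ.m≤n⇒m⊓n≡m F≤d)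
      contr-unif : IsUniform (E ─ F) (contrInd E Ind F) (d ∸ ∣ F ∣)
      contr-unif = uniform-contr {Ind = Ind} unif F F⊆E F≤d
      size : ∣ E ─ F ∣ ≡ N ∸ ∣ F ∣
      size = trans (sym (ℕₚ.m+n∸n≡m (∣ E ─ F ∣) (∣ F ∣))) (cong (_∸ (∣ F ∣)) (∣─∣ E F F⊆E))
      d-F≤ : d ∸ ∣ F ∣ ≤ ∣ E ─ F ∣
      d-F≤ = ℕₚ.≤-trans (ℕₚ.∸-monoˡ-≤ (∣ F ∣) d≤E) (ℕₚ.≤-reflexive (sym size))
      by-size : sgn (∣ F ∣) ℤ.* revχ F i ≡ g (∣ F ∣)
      by-size with ℕₚ.<-cmp (∣ F ∣) j
      ... | tri< F<j _ _ = trans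
        (cong (λ z → sgn (∣ F ∣) ℤ.* z) (trans
          (uniform-revχ-< {Ind = contrInd E Ind F} contr-unif d-F≤ (ℕₚ.∸-monoʳ-< F<j (ℕₚ.<⇒≤ j<d)))
          (cong (λ m → sgn i ℤ.* binom m i) size)))
        (sym (g-<j (∣ F ∣) F<j))
      ... | tri≈ _ F≡j _ = trans
        (cong₂ (λ k z → sgn k ℤ.* z) F≡j (begin
          revχ F i
            ≡⟨ cong (λ k → revχ F (d ∸ k)) F≡j ⟨
          revχ F (d ∸ ∣ F ∣)
            ≡⟨ uniform-revχ-top {Ind = contrInd E Ind F} contr-unif (ℕₚ.m<n⇒0<n∸m F<d) d-F≤ ⟩
          möbius (d ∸ ∣ F ∣) (∣ E ─ F ∣)
            ≡⟨ cong₂ möbius (cong (d ∸_) F≡j) (trans size (cong (N ∸_) F≡j)) ⟩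
          möbius i (N ∸ j) ∎))
        (trans (sym g-≡j) (cong g (sym F≡j)))
      ... | tri> _ _ j<F = trans
        (cong (λ z → sgn (∣ F ∣) ℤ.* z) (uniform-revχ-> {Ind = contrInd E Ind F} contr-unif d-F≤ (ℕₚ.∸-monoʳ-< j<F F≤d)))
        (trans (ℤₚ.*-zeroʳ (sgn (∣ F ∣))) (sym (g->j (∣ F ∣) j<F)))
    top : summand E i ≡ + 0
    top = begin
      sgn (rk E IE) ℤ.* (Q n E IE *ᵖ revχ E) i
        ≡⟨ cong (λ r → sgn (rk E IE) ℤ.* (Q n E IE *ᵖ rev r (χ (E ─ E) (contrInd E Ind E))) i) rk-contr ⟩
      sgn (rk E IE) ℤ.* (Q n E IE *ᵖ rev 0 (χ (E ─ E) (contrInd E Ind E))) i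
        ≡⟨ cong (λ z → sgn (rk E IE) ℤ.* z) (*ᵖ-rev-0 (Q n E IE) (χ (E ─ E) (contrInd E Ind E)) i high-degree) ⟩
      sgn (rk E IE) ℤ.* + 0
        ≡⟨ ℤₚ.*-zeroʳ (sgn (rk E IE)) ⟩
      + 0 ∎
      where
      IE = restrInd E Ind E
      E─E : ∣ E ─ E ∣ ≡ 0
      E─E = ℕₚ.+-cancelʳ-≡ N (∣ E ─ E ∣) 0 (∣─∣ E E (⊆ᵇ-refl E))
      -- E may have more than d elements, outside the scope of `uniform-contr`, so the rank is
      -- bounded directly by the empty ground set.
      rk-contr : rk (E ─ E) (contrInd E Ind E) ≡ 0
      rk-contr = ℕₚ.n≤0⇒n≡0 (foldr-⊔-≤ _ ∣_∣ (allSubsets n) (λ Y p →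
        ℕₚ.≤-trans (⊆ᵇ⇒∣∣≤ Y (E ─ E) (∧-trueʳ {contrInd E Ind E Y} p)) (ℕₚ.≤-reflexive E─E)))
      restr-unif : IsUniform E IE (N ⊓ d)
      restr-unif = uniform-restr {Ind = Ind} unif E (⊆ᵇ-refl E)
      rk-E : rk E IE ≡ d
      rk-E = trans (uniform-rk {Ind = IE} restr-unif (ℕₚ.m⊓n≤m N d)) (ℕₚ.m≥n⇒m⊓n≡n d≤E)
      high-degree : ∀ k → i ≤ k → Q n E IE k ≡ + 0
      high-degree k i≤k = degree n E IE (uniform-isMatroid {Ind = IE} restr-unif)
        (subst (0 <_) (sym rk-E) (ℕₚ.≤-<-trans z≤n j<d)) k
        (ℕₚ.≤-trans (ℕₚ.≤-reflexive rk-E) (ℕₚ.≤-trans d≤2i (ℕₚ.*-monoʳ-≤ 2 i≤k)))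
    inside : ∀ F → F ⊆ᵇ E ≡ true → (if isFlat E Ind F then summand F i else + 0) ≡ g ∣ F ∣
    inside F F⊆E with ∣ F ∣ ℕ.<? d | ∣ F ∣ ℕ.<? N
    ... | yes F<d | _ = trans (if-true (isFlat-small {Ind = Ind} unif F F⊆E F<d)) (small F F⊆E F<d)
    ... | no F≮d | yes F<E = trans (if-false (isFlat-large {Ind = Ind} unif F F⊆E (ℕₚ.≮⇒≥ F≮d) F<E))
                                   (sym (g->j (∣ F ∣) (ℕₚ.<-≤-trans j<d (ℕₚ.≮⇒≥ F≮d))))
    ... | no F≮d | no F≮E rewrite ⊆ᵇ∧∣∣≥⇒≡ F E F⊆E (ℕₚ.≮⇒≥ F≮E) =
      trans (if-true (isFlat-top E Ind)) (trans top (sym (g->j N (ℕₚ.<-≤-trans j<d d≤E))))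
    rhs : sumᵖ (map summand (flats E Ind)) i ≡
      sgn i ℤ.* (binom N i ℤ.* altSum j (N ∸ i)) ℤ.+ binom N j ℤ.* (sgn j ℤ.* möbius i (N ∸ j))
    rhs = begin
      sumℤ (map (λ p → p i) (map summand (flats E Ind)))
        ≡⟨ cong sumℤ (map-∘ (flats E Ind)) ⟨
      sumℤ (map (λ F → summand F i) (flats E Ind))
        ≡⟨ sumℤ-filter (isFlat E Ind) (λ F → summand F i) (allSubsets n) ⟩
      subsetSum (λ F → if isFlat E Ind F then summand F i else + 0)
        ≡⟨ subsetSum-by-size g E inside (λ F F⊈E → if-false (isFlat-⊈ E F Ind F⊈E)) ⟩
      binomSum g N
        ≡⟨ binomSum-+ g₁ g₂ N ⟩
      binomSum g₁ N ℤ.+ binomSum g₂ N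
        ≡⟨ cong₂ ℤ._+_
             (trans (binomSum-*ˡ (sgn i) _ N) (cong (λ z → sgn i ℤ.* z) (binomSum-choose (below j sgn) i N)))
             (binomSum-pointMass j _ N) ⟩
      sgn i ℤ.* (binom N i ℤ.* altSum j (N ∸ i)) ℤ.+ binom N j ℤ.* (sgn j ℤ.* möbius i (N ∸ j)) ∎

-- Boolean matroids

sgn-cancel : ∀ d x y → sgn d ℤ.* x ≡ sgn d ℤ.* y → x ≡ y
sgn-cancel d x y eq = trans (sym (twice x)) (trans (cong (λ z → sgn d ℤ.* z) eq) (twice y))
  where
  twice : ∀ z → sgn d ℤ.* (sgn d ℤ.* z) ≡ z
  twice z = trans (sym (ℤₚ.*-assoc (sgn d) (sgn d) z)) (trans (cong (ℤ._* z) (sgn-sq d)) (ℤₚ.*-identityˡ z))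

-- Induction on a bound s for ∣E∣: proper restrictions are Boolean and smaller, but live in the same
-- ambient `Fin n`, so neither n nor E decreases structurally. Exponents with 2k ≥ ∣E∣ are settled
-- by the degree bound.
boolean-Q : (Q : Assignment) → IsInverseKL Q → ∀ s {n} (E : Subset n) Ind → ∣ E ∣ ≤ s →
  IsUniform E Ind ∣ E ∣ → Q n E Ind ≈ᵖ onePoly
boolean-Q Q KL s {n} E Ind E≤s unif k with ∣ E ∣ ℕ.≟ 0
... | yes E≡0 = IsInverseKL.rank-zero KL n E Ind (uniform-isMatroid {Ind = Ind} unif)
                  (trans (uniform-rk {Ind = Ind} unif ℕₚ.≤-refl) E≡0) k
boolean-Q Q KL zero    {n} E Ind E≤s unif k | no E≢0 = ⊥-elim (E≢0 (ℕₚ.n≤0⇒n≡0 E≤s))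
boolean-Q Q KL (suc s) {n} E Ind E≤s unif k | no E≢0 with 2 ℕ.* k ℕ.<? ∣ E ∣
... | no 2k≮E = trans
  (IsInverseKL.degree KL n E Ind (uniform-isMatroid {Ind = Ind} unif)
    (subst (0 <_) (sym rk≡) (ℕₚ.n≢0⇒n>0 E≢0)) k (ℕₚ.≤-trans (ℕₚ.≤-reflexive rk≡) (ℕₚ.≮⇒≥ 2k≮E)))
  (sym (one-positive k (λ k≡0 → E≢0 (ℕₚ.n≤0⇒n≡0 (subst (λ k → ∣ E ∣ ≤ 2 ℕ.* k) k≡0 (ℕₚ.≮⇒≥ 2k≮E))))))
  where
  rk≡ : rk E Ind ≡ ∣ E ∣
  rk≡ = uniform-rk {Ind = Ind} unif ℕₚ.≤-refl
  one-positive : ∀ k → k ≢ 0 → onePoly k ≡ + 0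
  one-positive zero    k≢0 = ⊥-elim (k≢0 refl)
  one-positive (suc k) _   = refl
... | yes 2k<E = sgn-cancel (∣ E ∣) _ _ (trans
  (uniform-coefficient Q KL {Ind = Ind} unif ℕₚ.≤-refl restriction k 2k<E) (value (∣ E ∣) k k<E))
  where
  open ≡-Reasoning
  k<E : k < ∣ E ∣
  k<E = ℕₚ.≤-<-trans (ℕₚ.m≤m+n k _) 2k<E
  restriction : ∀ F → F ⊆ᵇ E ≡ true → ∣ F ∣ < ∣ E ∣ → Q n F (restrInd E Ind F) ≈ᵖ onePoly
  restriction F F⊆E F<E = boolean-Q Q KL s F (restrInd E Ind F) (ℕₚ.≤-pred (ℕₚ.≤-trans F<E E≤s))
    (subst (IsUniform F (restrInd E Ind F)) (ℕₚ.m≤n⇒m⊓n≡m (ℕₚ.<⇒≤ F<E)) (uniform-restr {Ind = Ind} unif F F⊆E))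
  value : ∀ N k → k < N →
    sgn (N ∸ k) ℤ.* (binom N (N ∸ k) ℤ.* altSum k (N ∸ (N ∸ k)))
      ℤ.+ binom N k ℤ.* (sgn k ℤ.* möbius (N ∸ k) (N ∸ k)) ≡ sgn N ℤ.* onePoly k
  value N zero k<N rewrite möbius-diagonal N | binomSum-0 (N ∸ N) = simplify (sgn N) (binom N N)
    where
    simplify : ∀ σ b → σ ℤ.* (b ℤ.* + 0) ℤ.+ + 1 ℤ.* (+ 1 ℤ.* σ) ≡ σ ℤ.* + 1
    simplify = solve-∀
  -- Naming the difference i writes N as i + (k+1). Both terms are then C(N,k+1) up to sign, with
  -- opposite signs.
  value N (suc k) k<N with N ∸ suc k | ℕₚ.m∸n+n≡m (ℕₚ.<⇒≤ k<N)
  ... | i | refl rewrite ℕₚ.m+n∸m≡n i (suc k) | möbius-diagonal i | altSum-suc k k | binom-n-n k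
                       | binom-sym i (suc k) | sgn-suc k =
    simplify (sgn i) (binom (i + suc k) (suc k)) (sgn k) (sgn (i + suc k))
    where
    simplify : ∀ σ b τ ρ → σ ℤ.* (b ℤ.* (τ ℤ.* + 1)) ℤ.+ b ℤ.* (- τ ℤ.* σ) ≡ ρ ℤ.* + 0
    simplify = solve-∀

-- Clearing denominators in the coefficient formula

-- The closed form (-1)^(r-1) C(n-1,r-1), multiplied by n so that no predecessors occur and the
-- cases r = 0 and n = 0 fit in.
altSum-absorption : ∀ r n → + n ℤ.* altSum r n ≡ - (sgn r ℤ.* (+ r ℤ.* binom n r))
altSum-absorption zero n rewrite binomSum-0 n = ℤₚ.*-zeroʳ (+ n)
altSum-absorption (suc r) zero rewrite ℤₚ.*-zeroʳ (+ suc r) | ℤₚ.*-zeroʳ (sgn (suc r)) = refl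
altSum-absorption (suc r) (suc n) = begin
  + suc n ℤ.* altSum (suc r) (suc n)
    ≡⟨ cong (λ z → + suc n ℤ.* z) (altSum-suc r n) ⟩
  + suc n ℤ.* (sgn r ℤ.* binom n r)
    ≡⟨ swap (+ suc n) (sgn r) (binom n r) ⟩
  sgn r ℤ.* (+ suc n ℤ.* binom n r)
    ≡⟨ cong (λ z → sgn r ℤ.* z) (binom-absorption n r) ⟨
  sgn r ℤ.* (+ suc r ℤ.* binom (suc n) (suc r))
    ≡⟨ negate (sgn r) (+ suc r ℤ.* binom (suc n) (suc r)) ⟩
  - (- sgn r ℤ.* (+ suc r ℤ.* binom (suc n) (suc r)))
    ≡⟨ cong (λ σ → - (σ ℤ.* (+ suc r ℤ.* binom (suc n) (suc r)))) (sgn-suc r) ⟨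
  - (sgn (suc r) ℤ.* (+ suc r ℤ.* binom (suc n) (suc r))) ∎
  where
  open ≡-Reasoning
  swap : ∀ a b c → a ℤ.* (b ℤ.* c) ≡ b ℤ.* (a ℤ.* c)
  swap = solve-∀
  negate : ∀ a b → a ℤ.* b ≡ - (- a ℤ.* b)
  negate = solve-∀

möbius-absorption : ∀ r n → 0 < n → + n ℤ.* möbius r n ≡ sgn r ℤ.* (+ r ℤ.* binom n r)
möbius-absorption r (suc n) _ = trans (sym (ℤₚ.neg-distribʳ-* (+ suc n) (altSum r (suc n))))
  (trans (cong -_ (altSum-absorption r (suc n))) (ℤₚ.neg-involutive _))

-- In unnormalised rationals equality is cross multiplication, so the reduction to lowest terms
-- performed by `_/_` need not be analysed.
fraction-product : ∀ q a p r → q ℤ.* (+ suc p ℤ.* + suc r) ≡ a →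
  q / 1 ≡ (a / suc p) ℚ.* (+ 1 / suc r)
fraction-product q a p r eq = ℚₚ.toℚᵘ-injective (begin-equality
  ℚ.toℚᵘ (q / 1)
    ≃⟨ ℚₚ.toℚᵘ-fromℚᵘ (mkℚᵘ q 0) ⟩
  mkℚᵘ q 0
    ≃⟨ *≡* cross ⟩
  mkℚᵘ a p ℚᵘ.* mkℚᵘ (+ 1) r
    ≃⟨ ℚᵘₚ.*-cong (ℚₚ.toℚᵘ-fromℚᵘ (mkℚᵘ a p)) (ℚₚ.toℚᵘ-fromℚᵘ (mkℚᵘ (+ 1) r)) ⟨
  ℚ.toℚᵘ (a / suc p) ℚᵘ.* ℚ.toℚᵘ (+ 1 / suc r)
    ≃⟨ ℚₚ.toℚᵘ-homo-* (a / suc p) (+ 1 / suc r) ⟨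
  ℚ.toℚᵘ ((a / suc p) ℚ.* (+ 1 / suc r)) ∎)
  where
  open ℚᵘₚ.≤-Reasoning
  cross : q ℤ.* (+ suc p ℤ.* + suc r) ≡ a ℤ.* + 1 ℤ.* + 1
  cross = trans eq (sym (trans (ℤₚ.*-identityʳ (a ℤ.* + 1)) (ℤₚ.*-identityʳ a)))

m+[j+i]∸i≡m+j : ∀ m j i → m + (j + i) ∸ i ≡ m + j
m+[j+i]∸i≡m+j m j i = trans (cong (_∸ i) (sym (ℕₚ.+-assoc m j i))) (ℕₚ.m+n∸n≡m (m + j) i)

m+[j+i]∸j≡m+i : ∀ m j i → m + (j + i) ∸ j ≡ m + i
m+[j+i]∸j≡m+i m j i = trans (ℕₚ.+-∸-assoc m (ℕₚ.m≤m+n j i)) (cong (λ e → m + e) (ℕₚ.m+n∸m≡n j i))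

-- With i = d − j and N = m + d this is (d−j)/(N−j) − j/(N−i) = m(d−2j)/((m+j)(m+d−j)), cleared of denominators.
uniform-coefficient-product : ∀ m j i q → 0 < i →
  let d = j + i ; N = m + d in
  sgn d ℤ.* q ≡
    sgn i ℤ.* (binom N i ℤ.* altSum j (m + j)) ℤ.+ binom N j ℤ.* (sgn j ℤ.* möbius i (m + i)) →
  q ℤ.* (+ (m + j) ℤ.* + (m + i)) ≡ binom N d ℤ.* + m ℤ.* (+ i ℤ.- + j) ℤ.* binom d j
uniform-coefficient-product m j i q 0<i eq = sgn-cancel d _ _ (begin
  sgn d ℤ.* (q ℤ.* (P ℤ.* R))
    ≡⟨ ℤₚ.*-assoc (sgn d) q (P ℤ.* R) ⟨
  sgn d ℤ.* q ℤ.* (P ℤ.* R)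
    ≡⟨ cong (ℤ._* (P ℤ.* R)) eq ⟩
  (sgn i ℤ.* (bᵢ ℤ.* A) ℤ.+ bⱼ ℤ.* (sgn j ℤ.* M)) ℤ.* (P ℤ.* R)
    ≡⟨ distribute (sgn i) (sgn j) bᵢ bⱼ A M P R ⟩
  sgn i ℤ.* bᵢ ℤ.* R ℤ.* (P ℤ.* A) ℤ.+ sgn j ℤ.* bⱼ ℤ.* P ℤ.* (R ℤ.* M)
    ≡⟨ cong₂ (λ x y → sgn i ℤ.* bᵢ ℤ.* R ℤ.* x ℤ.+ sgn j ℤ.* bⱼ ℤ.* P ℤ.* y)
         (altSum-absorption j (m + j)) (möbius-absorption i (m + i) (ℕₚ.≤-trans 0<i (ℕₚ.m≤n+m i m))) ⟩
  sgn i ℤ.* bᵢ ℤ.* R ℤ.* - (sgn j ℤ.* (+ j ℤ.* binom (m + j) j))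
    ℤ.+ sgn j ℤ.* bⱼ ℤ.* P ℤ.* (sgn i ℤ.* (+ i ℤ.* binom (m + i) i))
    ≡⟨ collect (sgn i) (sgn j) bᵢ bⱼ (binom (m + j) j) (binom (m + i) i) (+ i) (+ j) P R ⟩
  sgn j ℤ.* sgn i ℤ.* (P ℤ.* + i ℤ.* (bⱼ ℤ.* binom (m + i) i) ℤ.- R ℤ.* + j ℤ.* (bᵢ ℤ.* binom (m + j) j))
    ≡⟨ cong₂ (λ x y → x ℤ.* (P ℤ.* + i ℤ.* K ℤ.- R ℤ.* + j ℤ.* y)) (sym (sgn-+ j i)) K-sym ⟩
  sgn d ℤ.* (P ℤ.* + i ℤ.* K ℤ.- R ℤ.* + j ℤ.* K)
    ≡⟨ cong₂ (λ p r → sgn d ℤ.* (p ℤ.* + i ℤ.* K ℤ.- r ℤ.* + j ℤ.* K)) (ℤₚ.pos-+ m j) (ℤₚ.pos-+ m i) ⟩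
  sgn d ℤ.* ((+ m ℤ.+ + j) ℤ.* + i ℤ.* K ℤ.- (+ m ℤ.+ + i) ℤ.* + j ℤ.* K)
    ≡⟨ cong (λ z → sgn d ℤ.* z) (difference (+ m) (+ i) (+ j) K) ⟩
  sgn d ℤ.* (K ℤ.* (+ m ℤ.* (+ i ℤ.- + j)))
    ≡⟨ cong (λ z → sgn d ℤ.* (z ℤ.* (+ m ℤ.* (+ i ℤ.- + j)))) K≡ ⟩
  sgn d ℤ.* (binom N d ℤ.* binom d j ℤ.* (+ m ℤ.* (+ i ℤ.- + j)))
    ≡⟨ cong (λ z → sgn d ℤ.* z) (reorder (binom N d) (binom d j) (+ m) (+ i ℤ.- + j)) ⟩
  sgn d ℤ.* (binom N d ℤ.* + m ℤ.* (+ i ℤ.- + j) ℤ.* binom d j) ∎)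
  where
  open ≡-Reasoning
  d N : ℕ
  d = j + i
  N = m + d
  P R bᵢ bⱼ A M K : ℤ
  P = + (m + j)
  R = + (m + i)
  bᵢ = binom N i
  bⱼ = binom N j
  A = altSum j (m + j)
  M = möbius i (m + i)
  -- The trinomial coefficient N!/(m! i! j!). It is common to both terms, and it equals C(N,d)
  -- C(d,j), the product in the stated coefficient.
  K = bⱼ ℤ.* binom (m + i) i
  K-sym : bᵢ ℤ.* binom (m + j) j ≡ K
  K-sym = begin
    bᵢ ℤ.* binom (m + j) j       ≡⟨ cong (λ e → bᵢ ℤ.* binom e j) (m+[j+i]∸i≡m+j m j i) ⟨
    bᵢ ℤ.* binom (N ∸ i) j       ≡⟨ binom-trinomial N i j ⟩
    bⱼ ℤ.* binom (N ∸ j) i       ≡⟨ cong (λ e → bⱼ ℤ.* binom e i) (m+[j+i]∸j≡m+i m j i) ⟩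
    bⱼ ℤ.* binom (m + i) i       ∎
  K≡ : K ≡ binom N d ℤ.* binom d j
  K≡ = begin
    bⱼ ℤ.* binom (m + i) i       ≡⟨ cong (λ z → bⱼ ℤ.* z) (binom-sym m i) ⟨
    bⱼ ℤ.* binom (m + i) m       ≡⟨ cong (λ e → bⱼ ℤ.* binom e m) (m+[j+i]∸j≡m+i m j i) ⟨
    bⱼ ℤ.* binom (N ∸ j) m       ≡⟨ binom-trinomial N j m ⟩
    binom N m ℤ.* binom (N ∸ m) j ≡⟨ cong₂ (λ z e → z ℤ.* binom e j) (binom-sym m d) (ℕₚ.m+n∸m≡n m d) ⟩
    binom N d ℤ.* binom d j      ∎
  distribute : ∀ σ τ b c A M P R → (σ ℤ.* (b ℤ.* A) ℤ.+ c ℤ.* (τ ℤ.* M)) ℤ.* (P ℤ.* R) ≡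
    σ ℤ.* b ℤ.* R ℤ.* (P ℤ.* A) ℤ.+ τ ℤ.* c ℤ.* P ℤ.* (R ℤ.* M)
  distribute = solve-∀
  collect : ∀ σ τ b c u v i j P R → σ ℤ.* b ℤ.* R ℤ.* - (τ ℤ.* (j ℤ.* u)) ℤ.+ τ ℤ.* c ℤ.* P ℤ.* (σ ℤ.* (i ℤ.* v)) ≡
    τ ℤ.* σ ℤ.* (P ℤ.* i ℤ.* (c ℤ.* v) ℤ.- R ℤ.* j ℤ.* (b ℤ.* u))
  collect = solve-∀
  difference : ∀ m i j K → (m ℤ.+ j) ℤ.* i ℤ.* K ℤ.- (m ℤ.+ i) ℤ.* j ℤ.* K ≡ K ℤ.* (m ℤ.* (i ℤ.- j))
  difference = solve-∀
  reorder : ∀ b c m e → b ℤ.* c ℤ.* (m ℤ.* e) ≡ b ℤ.* m ℤ.* e ℤ.* c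
  reorder = solve-∀

-- The matroids U_{m,d}

∣U-E∣ : ∀ n → ∣ tabulate {n = n} (λ _ → true) ∣ ≡ n
∣U-E∣ zero    = refl
∣U-E∣ (suc n) = cong suc (∣U-E∣ n)

U-uniform : ∀ m d → IsUniform (U-E m d) (U-Ind m d) d
U-uniform m d X = sym (cong (_∧ (∣ X ∣ ≤ᵇ d)) (all-⊆ᵇ X))
  where
  all-⊆ᵇ : ∀ {n} (X : Subset n) → X ⊆ᵇ tabulate (λ _ → true) ≡ true
  all-⊆ᵇ []          = refl
  all-⊆ᵇ (true ∷ X)  = all-⊆ᵇ X
  all-⊆ᵇ (false ∷ X) = all-⊆ᵇ X

-- Writing d as j + i turns 2j < d into j < i and d - 2j into i - j, so truncated subtraction
-- disappears from the algebra.
U-coefficient : (Q : Assignment) → IsInverseKL Q → ∀ m′ j i → j < i →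
  Q (suc m′ + (j + i)) (U-E (suc m′) (j + i)) (U-Ind (suc m′) (j + i)) j / 1 ≡ uCoeff (suc m′) (j + i) j
U-coefficient Q KL m′ j i j<i = trans
  (fraction-product q _ (m′ + j) (m′ + i)
    (trans (uniform-coefficient-product m j i q (ℕₚ.≤-<-trans z≤n j<i) coefficient)
      (cong₂ ℤ._*_ (cong₂ ℤ._*_ (cong (ℤ._* + m) (binom≡C N d)) i-j) (binom≡C d j))))
  (cong (λ e → (numerator / suc (m′ + j)) ℚ.* (+ 1 / suc (m′ + e))) (sym d∸j))
  where
  m d N : ℕ
  m = suc m′
  d = j + i
  N = m + d
  q numerator : ℤ
  q = Q N (U-E m d) (U-Ind m d) j
  numerator = + (N C d) ℤ.* + m ℤ.* (+ d ℤ.- + (2 ℕ.* j)) ℤ.* + (d C j)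
  d∸j : d ∸ j ≡ i
  d∸j = ℕₚ.m+n∸m≡n j i
  i-j : + i ℤ.- + j ≡ + d ℤ.- + (2 ℕ.* j)
  i-j rewrite ℤₚ.pos-+ j i | ℤₚ.pos-* 2 j = double (+ i) (+ j)
    where
    double : ∀ i j → i ℤ.- j ≡ (j ℤ.+ i) ℤ.- + 2 ℤ.* j
    double = solve-∀
  unif : IsUniform (U-E m d) (U-Ind m d) d
  unif = U-uniform m d
  restriction : ∀ F → F ⊆ᵇ U-E m d ≡ true → ∣ F ∣ < d → Q N F (restrInd (U-E m d) (U-Ind m d) F) ≈ᵖ onePoly
  restriction F F⊆E F<d = boolean-Q Q KL (∣ F ∣) F (restrInd (U-E m d) (U-Ind m d) F) ℕₚ.≤-refl
    (subst (IsUniform F (restrInd (U-E m d) (U-Ind m d) F)) (ℕₚ.m≤n⇒m⊓n≡m (ℕₚ.<⇒≤ F<d))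
      (uniform-restr {Ind = U-Ind m d} unif F F⊆E))
  2j<d : 2 ℕ.* j < d
  2j<d = subst (λ e → j + e < d) (sym (ℕₚ.+-identityʳ j)) (ℕₚ.+-monoʳ-< j j<i)
  coefficient : sgn d ℤ.* q ≡
    sgn i ℤ.* (binom N i ℤ.* altSum j (m + j)) ℤ.+ binom N j ℤ.* (sgn j ℤ.* möbius i (m + i))
  coefficient = begin
    sgn d ℤ.* q
      ≡⟨ uniform-coefficient Q KL {Ind = U-Ind m d} unif
           (subst (d ≤_) (sym (∣U-E∣ N)) (ℕₚ.m≤n+m d m)) restriction j 2j<d ⟩
    value (∣ U-E m d ∣) (d ∸ j)
      ≡⟨ cong₂ value (∣U-E∣ N) d∸j ⟩
    value N i
      ≡⟨ cong₂ (λ x y → sgn i ℤ.* (binom N i ℤ.* altSum j x) ℤ.+ binom N j ℤ.* (sgn j ℤ.* möbius i y))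
           (m+[j+i]∸i≡m+j m j i) (m+[j+i]∸j≡m+i m j i) ⟩
    sgn i ℤ.* (binom N i ℤ.* altSum j (m + j)) ℤ.+ binom N j ℤ.* (sgn j ℤ.* möbius i (m + i)) ∎
    where
    open ≡-Reasoning
    value : ℕ → ℕ → ℤ
    value M i = sgn i ℤ.* (binom M i ℤ.* altSum j (M ∸ i)) ℤ.+ binom M j ℤ.* (sgn j ℤ.* möbius i (M ∸ j))

theorem3p3 : (Q : Assignment) → IsInverseKL Q →
    ∀ (m d : ℕ) → 1 ≤ m → 1 ≤ d →
    ∀ (j : ℕ) → (Q (m + d) (U-E m d) (U-Ind m d) j / 1) ≡ uRHS m d j
theorem3p3 Q KL (suc m′) (suc d′) _ _ j with j ℕ.≤? (d′ ℕ./ 2)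
-- With d = d′ + 1, the bound j ≤ ⌊d′/2⌋ says 2j < d, the range of the coefficient formula.
... | yes j≤ = trans
  (subst (λ d → Q (suc m′ + d) (U-E (suc m′) d) (U-Ind (suc m′) d) j / 1 ≡ uCoeff (suc m′) d j)
    (ℕₚ.m+[n∸m]≡n j≤d) (U-coefficient Q KL m′ j (suc d′ ∸ j) j<d-j))
  (sym (if-true (≤⇒≤ᵇ≡true j≤)))
  where
  j+j≤d′ : j + j ≤ d′
  j+j≤d′ = ℕₚ.≤-trans (ℕₚ.+-mono-≤ j≤ (ℕₚ.≤-trans j≤ (ℕₚ.m≤m+n _ 0)))
    (ℕₚ.≤-trans (ℕₚ.≤-reflexive (ℕₚ.*-comm 2 (d′ ℕ./ 2))) (m/n*n≤m d′ 2))
  j≤d : j ≤ suc d′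
  j≤d = ℕₚ.m≤n⇒m≤1+n (ℕₚ.≤-trans (ℕₚ.m≤m+n j j) j+j≤d′)
  j<d-j : j < suc d′ ∸ j
  j<d-j = ℕₚ.m+n≤o⇒m≤o∸n (suc j) (s≤s j+j≤d′)
... | no j≰ = trans
  (cong (_/ 1) (IsInverseKL.degree KL _ _ (U-Ind (suc m′) d) (uniform-isMatroid {Ind = U-Ind (suc m′) d} unif)
    (subst (0 <_) (sym rk≡d) (s≤s z≤n)) j (ℕₚ.≤-trans (ℕₚ.≤-reflexive rk≡d) d≤2j)))
  (sym (if-false (>⇒≤ᵇ≡false (ℕₚ.≰⇒> j≰))))
  where
  d : ℕ
  d = suc d′
  unif : IsUniform (U-E (suc m′) d) (U-Ind (suc m′) d) d
  unif = U-uniform (suc m′) d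
  rk≡d : rk (U-E (suc m′) d) (U-Ind (suc m′) d) ≡ d
  rk≡d = uniform-rk {Ind = U-Ind (suc m′) d} unif (subst (d ≤_) (sym (∣U-E∣ (suc m′ + d))) (ℕₚ.m≤n+m d (suc m′)))
  d≤2j : d ≤ 2 ℕ.* j
  -- Here d ≤ 2j is d′ < 2j; otherwise halving 2j ≤ d′ would give j ≤ ⌊d′/2⌋.
  d≤2j = ℕₚ.≰⇒> (λ 2j≤d′ → j≰ (subst (_≤ d′ ℕ./ 2)
    (trans (cong (ℕ._/ 2) (ℕₚ.*-comm 2 j)) (m*n/n≡m j 2)) (/-monoˡ-≤ 2 2j≤d′)))
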